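{- Let $n\ge 5$. Consider the following $\mathbb{F}_q$-subspaces of $\mathbb{F}_{q^n}^2$: (1) $U_1=\{(\sum_{i=0}^{n-3}c_1x_ib_1^i+\alpha+\beta a_1,\ \alpha+\beta b_1) : x_i,\alpha,\beta\in\mathbb{F}_q\}$, with $a_1,b_1,c_1\in\mathbb{F}_{q^n}^*$ such that $\mathbb{F}_q(b_1)=\mathbb{F}_{q^n}$, $1\in c_1\langle 1,b_1,\ldots,b_1^{n-2}\rangle_{\mathbb{F}_q}$ and $a_1\notin c_1\langle 1,b_1,\ldots,b_1^{n-2}\rangle_{\mathbb{F}_q}$; (2) if $n=t(\ell+1)$ with $\ell$ a positive integer: $U_2=\{(\overline{s}+\sum_{i=0}^{t-3}c_2x_ib_2^i+\alpha+\beta a_2,\ \alpha+\beta b_2) : x_i,\alpha,\beta\in\mathbb{F}_q,\ \overline{s}\in\overline{S}\}$, with $a_2,b_2,c_2\in\mathbb{F}_{q^n}^*$ and $\overline{S}\subseteq\mathbb{F}_{q^n}$ such that $\mathbb{F}_q(b_2)=\mathbb{F}_{q^t}$ with $3\le t\le n-3$, $\overline{S}$ is an $\mathbb{F}_{q^t}$-subspace of $\mathbb{F}_{q^t}$-dimension $\ell$ with $c_2\mathbb{F}_{q^t}\cap\overline{S}=\{0\}$, $1\in\overline{S}\oplus c_2\langle 1,b_2,\ldots,b_2^{t-2}\rangle_{\mathbb{F}_q}$ and $a_2\notin\overline{S}\oplus c_2\langle 1,b_2,\ldots,b_2^{t-2}\rangle_{\mathbb{F}_q}$; (3) if $n$ is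 even: $U_3=\{(\sum_{i=0}^{n/2-2}c_3x_i\gamma^i+\alpha+\beta a_3,\ \alpha+\beta b_3) : x_i\in\mathbb{F}_{q^2},\ \alpha,\beta\in\mathbb{F}_q\}$, with $a_3,b_3,c_3,\gamma\in\mathbb{F}_{q^n}^*$ such that $\mathbb{F}_q(b_3)=\mathbb{F}_{q^2}$, $\mathbb{F}_{q^2}(\gamma)=\mathbb{F}_{q^n}$, $1\in c_3\langle 1,\gamma,\ldots,\gamma^{n/2-2}\rangle_{\mathbb{F}_{q^2}}$ and $a_3\notin c_3\langle 1,\gamma,\ldots,\gamma^{n/2-2}\rangle_{\mathbb{F}_{q^2}}$. Then for $i\neq j$ (whenever both are defined), $U_i$ and $U_j$ are $\Gamma\mathrm{L}(2,q^n)$-inequivalent.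
   Context: $q$ is a prime power. The group $\Gamma\mathrm{L}(2,q^n)$ acts on $\mathbb{F}_{q^n}^2$ by $v\mapsto Mv^\rho$ with $M\in\mathrm{GL}(2,q^n)$ and $\rho\in\mathrm{Aut}(\mathbb{F}_{q^n})$ applied entrywise; two $\mathbb{F}_q$-subspaces are $\Gamma\mathrm{L}(2,q^n)$-equivalent if one is mapped onto the other by such an element. -}

module Defs where

open import Level using (Level; _⊔_; suc; Lift)
open import Algebra.Bundles using (CommutativeRing)
open import Data.Nat as ℕ using (ℕ; zero; _^_; _≤_; _∸_)
open import Data.Nat.Primality using (Prime)
open import Data.Fin using (Fin; toℕ)
import Data.Fin as Fin
open import Data.Product using (Σ; ∃; ∃-syntax; _×_; _,_)
open import Data.Unit.Polymorphic using (⊤)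
open import Relation.Nullary using (¬_)
open import Relation.Binary.PropositionalEquality using (_≡_)

IsPrimePower : ℕ → Set
IsPrimePower q = ∃[ p ] ∃[ k ] (Prime p × 1 ≤ k × q ≡ p ^ k)

record Fld (c ℓ : Level) : Set (suc (c ⊔ ℓ)) where
  field
    commRing : CommutativeRing c ℓ
  open CommutativeRing commRing public
  field
    1≉0 : ¬ (1# ≈ 0#)
    inverse : ∀ x → ¬ (x ≈ 0#) → Σ Carrier λ y → x * y ≈ 1#

module FieldDefs {c ℓ} (K : Fld c ℓ) (q n : ℕ) where
  open Fld K

  pow : Carrier → ℕ → Carrier
  pow x zero = 1#
  pow x (ℕ.suc k) = x * pow x k

  sumF : (k : ℕ) → (Fin k → Carrier) → Carrier
  sumF zero f = 0#
  sumF (ℕ.suc k) f = f Fin.zero + sumF k (λ i → f (Fin.suc i))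

  Sub : Set (suc (c ⊔ ℓ))
  Sub = Carrier → Set (c ⊔ ℓ)

  Sub2 : Set (suc (c ⊔ ℓ))
  Sub2 = Carrier × Carrier → Set (c ⊔ ℓ)

  SameSub : Sub → Sub → Set (c ⊔ ℓ)
  SameSub A B = ∀ x → (A x → B x) × (B x → A x)

  Full : Sub
  Full _ = ⊤

  -- the subfield F_{q^t} of F_{q^n} = K : fixed points of x ↦ x^(q^t)
  𝔽 : ℕ → Sub
  𝔽 t x = Lift (c ⊔ ℓ) (pow x (q ^ t) ≈ x)

  IsSubfield : Sub → Set (c ⊔ ℓ)
  IsSubfield P =
      (∀ x y → x ≈ y → P x → P y)
    × P 0# × P 1#
    × (∀ x y → P x → P y → P (x + y))
    × (∀ x → P x → P (- x))
    × (∀ x y → P x → P y → P (x * y))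
    × (∀ x y → P x → x * y ≈ 1# → P y)

  Gen : Sub → Carrier → Carrier → Set (suc (c ⊔ ℓ))
  Gen F b x = (P : Sub) → IsSubfield P → (∀ y → F y → P y) → P b → P x

  GenEq : Sub → Carrier → Sub → Set (suc (c ⊔ ℓ))
  GenEq F b E = ∀ x → (Gen F b x → E x) × (E x → Gen F b x)

  Span : Sub → (k : ℕ) → (Fin k → Carrier) → Sub
  Span F k v x = Σ (Fin k → Carrier) λ a → ((∀ i → F (a i)) × x ≈ sumF k (λ i → a i * v i))

  LinIndep : Sub → (k : ℕ) → (Fin k → Carrier) → Set (c ⊔ ℓ)
  LinIndep F k v = ∀ (a : Fin k → Carrier) → (∀ i → F (a i)) → sumF k (λ i → a i * v i) ≈ 0# → ∀ i → a i ≈ 0#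

  SubspaceOfDim : Sub → ℕ → Sub → Set (c ⊔ ℓ)
  SubspaceOfDim F d S = Σ (Fin d → Carrier) λ s → (LinIndep F d s × SameSub S (Span F d s))

  powers : Carrier → (k : ℕ) → Fin k → Carrier
  powers b k i = pow b (toℕ i)

  InScaledSpan : Sub → Carrier → Carrier → ℕ → Carrier → Set (c ⊔ ℓ)
  InScaledSpan F cc b k x = Σ Carrier λ w → (Span F k (powers b k) w × x ≈ cc * w)

  InSumSpan : Sub → Sub → Carrier → Carrier → ℕ → Carrier → Set (c ⊔ ℓ)
  InSumSpan S F cc b k x = Σ Carrier λ s → Σ Carrier λ w → (S s × Span F k (powers b k) w × x ≈ s + cc * w)

  Fq : Sub
  Fq = 𝔽 1

  U₁ : (a b cc : Carrier) → Sub2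
  U₁ a b cc (u , v) =
    Σ (Fin (n ∸ 2) → Carrier) λ x → Σ Carrier λ α → Σ Carrier λ β → ((∀ i → Fq (x i)) × Fq α × Fq β
      × u ≈ sumF (n ∸ 2) (λ i → cc * x i * pow b (toℕ i)) + α + β * a
      × v ≈ α + β * b)

  U₂ : (t : ℕ) (S : Sub) (a b cc : Carrier) → Sub2
  U₂ t S a b cc (u , v) =
    Σ Carrier λ s → Σ (Fin (t ∸ 2) → Carrier) λ x → Σ Carrier λ α → Σ Carrier λ β → (S s × (∀ i → Fq (x i)) × Fq α × Fq β
      × u ≈ s + sumF (t ∸ 2) (λ i → cc * x i * pow b (toℕ i)) + α + β * a
      × v ≈ α + β * b)

  -- m = n/2
  U₃ : (m : ℕ) (a b cc γ : Carrier) → Sub2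
  U₃ m a b cc γ (u , v) =
    Σ (Fin (m ∸ 1) → Carrier) λ x → Σ Carrier λ α → Σ Carrier λ β → ((∀ i → 𝔽 2 (x i)) × Fq α × Fq β
      × u ≈ sumF (m ∸ 1) (λ i → cc * x i * pow γ (toℕ i)) + α + β * a
      × v ≈ α + β * b)

  Hyp₁ : (a b cc : Carrier) → Set (suc (c ⊔ ℓ))
  Hyp₁ a b cc =
      ¬ (a ≈ 0#) × ¬ (b ≈ 0#) × ¬ (cc ≈ 0#)
    × GenEq Fq b Full
    × InScaledSpan Fq cc b (n ∸ 1) 1#
    × ¬ InScaledSpan Fq cc b (n ∸ 1) a

  Hyp₂ : (t l : ℕ) (S : Sub) (a b cc : Carrier) → Set (suc (c ⊔ ℓ))
  Hyp₂ t l S a b cc =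
      Lift (suc (c ⊔ ℓ)) (n ≡ t ℕ.* (l ℕ.+ 1) × 1 ≤ l × 3 ≤ t × t ℕ.+ 3 ≤ n)
    × ¬ (a ≈ 0#) × ¬ (b ≈ 0#) × ¬ (cc ≈ 0#)
    × GenEq Fq b (𝔽 t)
    × SubspaceOfDim (𝔽 t) l S
    × (∀ x → S x → (Σ Carrier λ y → (𝔽 t y × x ≈ cc * y)) → x ≈ 0#)
    × InSumSpan S Fq cc b (t ∸ 1) 1#
    × ¬ InSumSpan S Fq cc b (t ∸ 1) a

  Hyp₃ : (m : ℕ) (a b cc γ : Carrier) → Set (suc (c ⊔ ℓ))
  Hyp₃ m a b cc γ =
      Lift (suc (c ⊔ ℓ)) (n ≡ 2 ℕ.* m)
    × ¬ (a ≈ 0#) × ¬ (b ≈ 0#) × ¬ (cc ≈ 0#) × ¬ (γ ≈ 0#)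
    × GenEq Fq b (𝔽 2)
    × GenEq (𝔽 2) γ Full
    × InScaledSpan (𝔽 2) cc γ (m ∸ 1) 1#
    × ¬ InScaledSpan (𝔽 2) cc γ (m ∸ 1) a

  IsAut : (Carrier → Carrier) → Set (c ⊔ ℓ)
  IsAut ρ =
      (∀ x y → x ≈ y → ρ x ≈ ρ y)
    × (∀ x y → ρ (x + y) ≈ ρ x + ρ y)
    × (∀ x y → ρ (x * y) ≈ ρ x * ρ y)
    × ρ 1# ≈ 1#
    × (∀ x y → ρ x ≈ ρ y → x ≈ y)
    × (∀ y → Σ Carrier λ x → ρ x ≈ y)

  ΓLEquiv : Sub2 → Sub2 → Set (c ⊔ ℓ)
  ΓLEquiv U U' =
    Σ Carrier λ m₁₁ → Σ Carrier λ m₁₂ → Σ Carrier λ m₂₁ → Σ Carrier λ m₂₂ → Σ (Carrier → Carrier) λ ρ →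
      ( ¬ (m₁₁ * m₂₂ - m₁₂ * m₂₁ ≈ 0#)
      × IsAut ρ
      × (∀ u v → (U' (u , v) → Σ Carrier λ x → Σ Carrier λ y → (U (x , y) × u ≈ m₁₁ * ρ x + m₁₂ * ρ y × v ≈ m₂₁ * ρ x + m₂₂ * ρ y))
               × ((Σ Carrier λ x → Σ Carrier λ y → (U (x , y) × u ≈ m₁₁ * ρ x + m₁₂ * ρ y × v ≈ m₂₁ * ρ x + m₂₂ * ρ y)) → U' (u , v))))

HasCard : ∀ {c ℓ} → Fld c ℓ → ℕ → Set (c ⊔ ℓ)
HasCard K N = Σ (Fin N → Carrier) λ f → ((∀ i j → f i ≈ f j → i ≡ j) × (∀ x → Σ (Fin N) λ i → f i ≈ x))
  where open Fld K

{-# OPTIONS --safe #-}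
-- The invariant is the degree of 𝔽_q(b).  Every point of the linear set other than ⟨(1,0)⟩ has weight
-- at most 2, because its vectors are determined by their second coordinate in ⟨1, b⟩, while ⟨(1,0)⟩ has
-- weight n - 2 ≥ 3.  Hence a semilinear equivalence fixes ⟨(1,0)⟩ and is upper triangular, so ⟨1, b′⟩
-- is a multiple of ⟨1, ρ b⟩; therefore 𝔽_q(b′) = 𝔽_q(ρ b) and these fields have equal degree.
-- That degree is n, t with 3 ≤ t ≤ n - 3, or 2.
--
-- 𝔽 t ⊆ 𝔽 s is impossible for s < t = n / (l + 1): the norm x ↦ x^N, N = 1 + q^t + ⋯ + q^(tl), maps
-- K into 𝔽 t, so X^(N q^s) - X^N would vanish on K although its degree is less than q^n.
module Submission where

open import Defs
open import Data.Empty using (⊥-elim)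
open import Data.Fin using (Fin; zero; suc; toℕ; fromℕ; fromℕ<; inject₁)
open import Data.Fin.Permutation using (Permutation; permutation)
import Data.Fin.Properties as Fin
open import Data.Nat as ℕ using (ℕ; zero; suc; _≤_; _<_; s≤s; z≤n)
open import Data.Nat.Combinatorics using (_C_; nC1≡n; nCn≡1; nCk+nC[k+1]≡[n+1]C[k+1])
open import Data.Nat.Divisibility using (_∣_; divides; ∣⇒≤)
open import Data.Nat.Primality using (Prime; euclidsLemma; prime⇒nonTrivial)
import Data.Nat.Properties as ℕ
open import Data.Nat.Tactic.RingSolver using (solve-∀)
open import Data.Product using (Σ; _×_; _,_; proj₁; proj₂)
open import Data.Sum using (inj₁; inj₂)
open import Data.Unit.Polymorphic using (tt)
open import Data.Vec using (Vec; []; _∷_; _++_; replicate)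
open import Function using (_∘_)
open import Level using (_⊔_; lift)
open import Relation.Binary.PropositionalEquality as ≡ using (_≡_; cong)
open import Relation.Nullary using (¬_; Dec; yes; no; contradiction)

-- Binomial coefficients divisible by a prime.

-- Exhibits `suc n` as a divisor of `suc k` times a binomial coefficient, the input for Euclid's
-- lemma. The proof is an induction through Pascal's rule.
absorption : ∀ n k → suc k ℕ.* (suc n C suc k) ≡ suc n ℕ.* (n C k)
absorption n zero = ≡.trans (≡.cong (ℕ._+ 0) (nC1≡n (suc n))) (≡.trans (ℕ.+-identityʳ (suc n)) (≡.sym (ℕ.*-identityʳ (suc n))))
absorption zero (suc k) = ℕ.*-zeroʳ k
absorption (suc m) (suc j) = begin
  suc (suc j) ℕ.* (suc (suc m) C suc (suc j))
    ≡⟨ cong (suc (suc j) ℕ.*_) (nCk+nC[k+1]≡[n+1]C[k+1] (suc m) (suc j)) ⟨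
  suc (suc j) ℕ.* (A ℕ.+ B)
    -- One copy of `A` is split off so that the remaining coefficient `suc j` fits the induction
    -- hypothesis; it is merged back at the end.
    ≡⟨ rearr j A B ⟩
  A ℕ.+ (suc j ℕ.* A ℕ.+ suc (suc j) ℕ.* B)
    ≡⟨ cong (A ℕ.+_) (≡.cong₂ ℕ._+_ (absorption m j) (absorption m (suc j))) ⟩
  A ℕ.+ (suc m ℕ.* (m C j) ℕ.+ suc m ℕ.* (m C suc j))
    ≡⟨ cong (A ℕ.+_) (ℕ.*-distribˡ-+ (suc m) (m C j) (m C suc j)) ⟨
  A ℕ.+ suc m ℕ.* (m C j ℕ.+ m C suc j)
    ≡⟨ cong (λ z → A ℕ.+ suc m ℕ.* z) (nCk+nC[k+1]≡[n+1]C[k+1] m j) ⟩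
  suc (suc m) ℕ.* A ∎
  where
  open ≡.≡-Reasoning
  A B : ℕ
  A = suc m C suc j
  B = suc m C suc (suc j)
  rearr : ∀ j A B → suc (suc j) ℕ.* (A ℕ.+ B) ≡ A ℕ.+ (suc j ℕ.* A ℕ.+ suc (suc j) ℕ.* B)
  rearr = solve-∀

-- By absorption the prime divides `suc k` times the coefficient, and it is too large to divide
-- `suc k`.
prime∣choose : ∀ {m k} → Prime (suc m) → suc k < suc m → suc m ∣ (suc m C suc k)
prime∣choose {m} {k} pr k<m
  with euclidsLemma (suc k) (suc m C suc k) pr
         (divides (m C k) (≡.trans (absorption m k) (ℕ.*-comm (suc m) (m C k))))
... | inj₁ p∣k = contradiction (∣⇒≤ p∣k) (ℕ.<⇒≱ k<m)
... | inj₂ p∣C = p∣C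

-- Size of the norm exponent.

-- For `Q = q^t` and n = t(l + 1) this is the exponent of the norm from K to `𝔽 t`.
geometric : ℕ → ℕ → ℕ
geometric Q zero = 1
geometric Q (suc l) = geometric Q l ℕ.+ Q ℕ.^ suc l

-- Both sides are 1 + Q + ⋯ + Q^(l+1), split off at the bottom and at the top; a form without
-- subtraction of the geometric sum formula.
geometric-step : ∀ Q l → geometric Q l ℕ.* Q ℕ.+ 1 ≡ geometric Q l ℕ.+ Q ℕ.^ suc l
geometric-step Q zero = lemma Q
  where
  lemma : ∀ Q → 1 ℕ.* Q ℕ.+ 1 ≡ 1 ℕ.+ Q ℕ.* 1
  lemma = solve-∀
geometric-step Q (suc l) = ≡.trans (lemma₁ (geometric Q l) (Q ℕ.^ suc l) Q)
  (≡.cong (ℕ._+ Q ℕ.* Q ℕ.^ suc l) (geometric-step Q l))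
  where
  lemma₁ : ∀ g P Q → (g ℕ.+ P) ℕ.* Q ℕ.+ 1 ≡ (g ℕ.* Q ℕ.+ 1) ℕ.+ Q ℕ.* P
  lemma₁ = solve-∀

1≤geometric : ∀ Q l → 1 ≤ geometric Q l
1≤geometric Q zero = ℕ.≤-refl
1≤geometric Q (suc l) = ℕ.≤-trans (1≤geometric Q l) (ℕ.m≤m+n _ _)

-- Each term is at least twice the previous one, so the last term exceeds the sum of all earlier
-- ones.
geometric<2Q^l : ∀ Q l → 2 ≤ Q → geometric Q l < 2 ℕ.* Q ℕ.^ l
geometric<2Q^l Q zero 2≤Q = ℕ.≤-refl
geometric<2Q^l Q (suc l) 2≤Q = begin-strict
  geometric Q l ℕ.+ Q ℕ.^ suc l     <⟨ ℕ.+-monoˡ-< (Q ℕ.^ suc l) (geometric<2Q^l Q l 2≤Q) ⟩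
  2 ℕ.* Q ℕ.^ l ℕ.+ Q ℕ.^ suc l     ≤⟨ ℕ.+-monoˡ-≤ (Q ℕ.^ suc l) (ℕ.*-monoˡ-≤ (Q ℕ.^ l) 2≤Q) ⟩
  Q ℕ.^ suc l ℕ.+ Q ℕ.^ suc l       ≡⟨ cong (Q ℕ.^ suc l ℕ.+_) (ℕ.+-identityʳ (Q ℕ.^ suc l)) ⟨
  2 ℕ.* Q ℕ.^ suc l                 ∎
  where open ℕ.≤-Reasoning

2≤m^n : ∀ {m} n → 2 ≤ m → 1 ≤ n → 2 ≤ m ℕ.^ n
2≤m^n {m} (suc n) 2≤m _ = ℕ.*-mono-≤ {2} {m} {1} 2≤m (ℕ.m^n>0 m {{ℕ.>-nonZero (ℕ.<-trans (s≤s z≤n) 2≤m)}} n)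

-- The degree bound for the root count: the factor 2 is at most q, and the resulting q^(s+1) is at
-- most q^t.
geometric*q^s<q^n : ∀ q s t l → 2 ≤ q → s < t →
  geometric (q ℕ.^ t) l ℕ.* q ℕ.^ s < q ℕ.^ (t ℕ.* (l ℕ.+ 1))
geometric*q^s<q^n q s t l 2≤q s<t = begin-strict
  geometric Q l ℕ.* q ℕ.^ s       <⟨ ℕ.*-monoˡ-< (q ℕ.^ s) (geometric<2Q^l Q l (2≤m^n t 2≤q (ℕ.≤-trans (s≤s z≤n) s<t))) ⟩
  2 ℕ.* Q ℕ.^ l ℕ.* q ℕ.^ s       ≤⟨ ℕ.*-monoˡ-≤ (q ℕ.^ s) (ℕ.*-monoˡ-≤ (Q ℕ.^ l) 2≤q) ⟩
  q ℕ.* Q ℕ.^ l ℕ.* q ℕ.^ s       ≡⟨ lemma q (Q ℕ.^ l) (q ℕ.^ s) ⟩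
  q ℕ.^ suc s ℕ.* Q ℕ.^ l         ≤⟨ ℕ.*-monoˡ-≤ (Q ℕ.^ l) (ℕ.^-monoʳ-≤ q s<t) ⟩
  Q ℕ.^ suc l                     ≡⟨ ℕ.^-*-assoc q t (suc l) ⟩
  q ℕ.^ (t ℕ.* suc l)             ≡⟨ cong (λ z → q ℕ.^ (t ℕ.* z)) (ℕ.+-comm 1 l) ⟩
  q ℕ.^ (t ℕ.* (l ℕ.+ 1))         ∎
  where
  open ℕ.≤-Reasoning
  Q : ℕ
  Q = q ℕ.^ t
  instance
    q≢0 : ℕ.NonZero q
    q≢0 = ℕ.>-nonZero (ℕ.<-trans (s≤s z≤n) 2≤q)
    q^s≢0 : ℕ.NonZero (q ℕ.^ s)
    q^s≢0 = ℕ.m^n≢0 q s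
  lemma : ∀ a b c → a ℕ.* b ℕ.* c ≡ a ℕ.* c ℕ.* b
  lemma = solve-∀

-- Cancellation in fields and roots of monic polynomials.

module FieldProperties {c ℓ} (K : Fld c ℓ) where
  open Fld K hiding (zero)
  open import Algebra.Properties.CommutativeSemiring.Exp commutativeSemiring
    using (_^_; ^-congˡ; ^-congʳ; ^-homo-*; ^-assocʳ; ^-distrib-*) public
  open import Algebra.Properties.Semiring.Mult semiring
    using (×-comm-*; ×-assoc-*; ×-congʳ; ×-assocˡ; ×1-homo-*; ×-homo-1) renaming (_×_ to _·_) public
  import Algebra.Properties.CommutativeSemiring.Binomial commutativeSemiring as Binomial
  open import Algebra.Properties.Ring ring using (-1*x≈-x)
  open import Algebra.Properties.Group +-group using (∙-cancelˡ; x∙y⁻¹≈ε⇒x≈y) public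
  open import Algebra.Properties.Monoid.Sum +-monoid using (sum; sum-cong-≋; sum-init-last; sum-replicate-zero)
  open import Relation.Binary.Reasoning.Setoid setoid
  open import Algebra.Solver.Ring.NaturalCoefficients.Default commutativeSemiring

  *-cancelˡ : ∀ {x y z} → ¬ (x ≈ 0#) → x * y ≈ x * z → y ≈ z
  *-cancelˡ {x} {y} {z} x≉0 xy≈xz = begin
    y             ≈⟨ *-identityˡ y ⟨
    1# * y        ≈⟨ *-congʳ x⁻¹x≈1 ⟨
    x⁻¹ * x * y   ≈⟨ *-assoc _ _ _ ⟩
    x⁻¹ * (x * y) ≈⟨ *-congˡ xy≈xz ⟩
    x⁻¹ * (x * z) ≈⟨ *-assoc _ _ _ ⟨
    x⁻¹ * x * z   ≈⟨ *-congʳ x⁻¹x≈1 ⟩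
    1# * z        ≈⟨ *-identityˡ z ⟩
    z             ∎
    where
    x⁻¹ : Carrier
    x⁻¹ = proj₁ (inverse x x≉0)
    x⁻¹x≈1 : x⁻¹ * x ≈ 1#
    x⁻¹x≈1 = trans (*-comm x⁻¹ x) (proj₂ (inverse x x≉0))

  x*y≈0⇒y≈0 : ∀ {x y} → ¬ (x ≈ 0#) → x * y ≈ 0# → y ≈ 0#
  x*y≈0⇒y≈0 x≉0 xy≈0 = *-cancelˡ x≉0 (trans xy≈0 (sym (zeroʳ _)))

  x*y≉0 : ∀ {x y} → ¬ (x ≈ 0#) → ¬ (y ≈ 0#) → ¬ (x * y ≈ 0#)
  x*y≉0 x≉0 y≉0 xy≈0 = y≉0 (x*y≈0⇒y≈0 x≉0 xy≈0)

  x-y≉0 : ∀ {x y} → ¬ (x ≈ y) → ¬ (x - y ≈ 0#)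
  x-y≉0 x≉y x-y≈0 = x≉y (x∙y⁻¹≈ε⇒x≈y _ _ x-y≈0)

  0^n≈0 : ∀ n → 1 ≤ n → 0# ^ n ≈ 0#
  0^n≈0 (suc n) _ = zeroˡ _

  1^n≈1 : ∀ n → 1# ^ n ≈ 1#
  1^n≈1 zero = refl
  1^n≈1 (suc n) = trans (*-identityˡ _) (1^n≈1 n)

  -- The vector a₀, …, a_{d-1} encodes the monic polynomial a₀ + a₁X + ⋯ + a_{d-1}X^{d-1} + X^d.
  evalMonic : ∀ {d} → Vec Carrier d → Carrier → Carrier
  evalMonic [] x = 1#
  evalMonic (a ∷ as) x = a + x * evalMonic as x

  -- Synthetic division by X - r: the coefficients of the quotient are the intermediate values of
  -- Horner's scheme at r. The quotient is again monic, one degree lower.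
  divideMonic : ∀ {d} (as : Vec Carrier (suc d)) r → Σ (Vec Carrier d) λ bs →
    ∀ x → evalMonic as x ≈ (x - r) * evalMonic bs x + evalMonic as r
  divideMonic (a ∷ []) r = [] , λ x → sym (begin
    (x - r) * 1# + (a + r * 1#) ≈⟨ solve 4 (λ x m r a → (x :+ m) :* con 1 :+ (a :+ r :* con 1) := a :+ x :* con 1 :+ (m :+ r)) refl x (- r) r a ⟩
    a + x * 1# + (- r + r)      ≈⟨ +-congˡ (-‿inverseˡ r) ⟩
    a + x * 1# + 0#             ≈⟨ +-identityʳ _ ⟩
    a + x * 1#                  ∎)
  divideMonic (a ∷ as@(_ ∷ _)) r with divideMonic as r
  ... | bs , as≈ = evalMonic as r ∷ bs , λ x → let g = evalMonic as r ; h = evalMonic bs x in sym (begin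
    (x - r) * (g + x * h) + (a + r * g)
      ≈⟨ solve 6 (λ x m r a g h → (x :+ m) :* (g :+ x :* h) :+ (a :+ r :* g) := a :+ x :* ((x :+ m) :* h :+ g) :+ (m :+ r) :* g) refl x (- r) r a g h ⟩
    a + x * ((x - r) * h + g) + (- r + r) * g
      ≈⟨ +-cong (+-congˡ (*-congˡ (sym (as≈ x)))) (trans (*-congʳ (-‿inverseˡ r)) (zeroˡ g)) ⟩
    a + x * evalMonic as x + 0#
      ≈⟨ +-identityʳ _ ⟩
    a + x * evalMonic as x ∎)

  -- Dividing by X - `r zero` keeps the other roots, since `r (suc i) - r zero` is nonzero and can
  -- be cancelled. In degree 0 the polynomial is 1 and has no root.
  monic-roots-≤-degree : ∀ {d m} (as : Vec Carrier d) (r : Fin m → Carrier) →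
    (∀ i j → r i ≈ r j → i ≡ j) → (∀ i → evalMonic as (r i) ≈ 0#) → m ≤ d
  monic-roots-≤-degree {d} {zero} as r inj root = z≤n
  monic-roots-≤-degree {zero} {suc m} [] r inj root = ⊥-elim (1≉0 (root zero))
  monic-roots-≤-degree {suc d} {suc m} as r inj root with divideMonic as (r zero)
  ... | bs , as≈ = s≤s (monic-roots-≤-degree bs (λ i → r (suc i))
          (λ i j e → Fin.suc-injective (inj _ _ e))
          (λ i → x*y≈0⇒y≈0 (x-y≉0 λ e → Fin.0≢1+n (≡.sym (inj _ _ e))) (begin
             (r (suc i) - r zero) * evalMonic bs (r (suc i))       ≈⟨ +-identityʳ _ ⟨
             (r (suc i) - r zero) * evalMonic bs (r (suc i)) + 0#  ≈⟨ +-congˡ (root zero) ⟨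
             _                                                     ≈⟨ as≈ (r (suc i)) ⟨
             evalMonic as (r (suc i))                              ≈⟨ root (suc i) ⟩
             0# ∎)))

  evalMonic-replicate0 : ∀ d x → evalMonic (replicate d 0#) x ≈ x ^ d
  evalMonic-replicate0 zero x = refl
  evalMonic-replicate0 (suc d) x = trans (+-identityˡ _) (*-congˡ (evalMonic-replicate0 d x))

  evalMonic-shift : ∀ {d} m (as : Vec Carrier d) x → evalMonic (replicate m 0# ++ as) x ≈ x ^ m * evalMonic as x
  evalMonic-shift zero as x = sym (*-identityˡ _)
  evalMonic-shift (suc m) as x = begin
    0# + x * evalMonic (replicate m 0# ++ as) x ≈⟨ +-identityˡ _ ⟩
    x * evalMonic (replicate m 0# ++ as) x      ≈⟨ *-congˡ (evalMonic-shift m as x) ⟩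
    x * (x ^ m * evalMonic as x)                ≈⟨ *-assoc _ _ _ ⟨
    x * x ^ m * evalMonic as x                  ∎

  -- The values of `r` are distinct roots of the monic polynomial X^a - X^b.
  x^a≈x^b⇒card≤a : ∀ {m a b} → b < a → (r : Fin m → Carrier) → (∀ i j → r i ≈ r j → i ≡ j) →
    (∀ i → r i ^ a ≈ r i ^ b) → m ≤ a
  x^a≈x^b⇒card≤a {m} {a} {b} b<a r inj eq =
    ≡.subst (m ≤_) a≡ (monic-roots-≤-degree as r inj root)
    where
    k : ℕ
    k = a ℕ.∸ suc b
    a≡ : b ℕ.+ suc k ≡ a
    a≡ = ≡.trans (ℕ.+-suc b k) (ℕ.m+[n∸m]≡n b<a)
    as : Vec Carrier (b ℕ.+ suc k)
    -- The coefficient -1 stands at X^b, followed by `k` = a - b - 1 zeros below the implicit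
    -- leading term X^a.
    as = replicate b 0# ++ (- 1# ∷ replicate k 0#)
    root : ∀ i → evalMonic as (r i) ≈ 0#
    root i = begin
      evalMonic as x                                       ≈⟨ evalMonic-shift b _ x ⟩
      x ^ b * (- 1# + x * evalMonic (replicate k 0#) x)    ≈⟨ *-congˡ (+-congˡ (*-congˡ (evalMonic-replicate0 k x))) ⟩
      x ^ b * (- 1# + x ^ suc k)                           ≈⟨ distribˡ _ _ _ ⟩
      x ^ b * - 1# + x ^ b * x ^ suc k                     ≈⟨ +-cong (trans (*-comm _ _) (-1*x≈-x _)) (sym (^-homo-* x b (suc k))) ⟩
      - (x ^ b) + x ^ (b ℕ.+ suc k)                        ≈⟨ +-congˡ (trans (^-congʳ x a≡) (eq i)) ⟩
      - (x ^ b) + x ^ b                                    ≈⟨ -‿inverseˡ _ ⟩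
      0#                                                   ∎
      where x = r i

  -- Additivity of the Frobenius map.

  ·-∣ : ∀ {p m} x → p · 1# ≈ 0# → p ∣ m → m · x ≈ 0#
  ·-∣ {p} x p≈0 (divides k ≡.refl) = begin
    (k ℕ.* p) · x              ≈⟨ ×-assocˡ x k p ⟨
    k · (p · x)                ≈⟨ ×-congʳ k (×-congʳ p (*-identityˡ x)) ⟨
    k · (p · (1# * x))         ≈⟨ ×-congʳ k (×-assoc-* p 1# x) ⟨
    k · (p · 1# * x)           ≈⟨ ×-congʳ k (trans (*-congʳ p≈0) (zeroˡ x)) ⟩
    -- Writing 0 as a product lets one factor be pulled out of the multiple, which then vanishes.
    k · 0#                     ≈⟨ ×-congʳ k (zeroʳ 0#) ⟨
    k · (0# * 0#)              ≈⟨ ×-comm-* k 0# 0# ⟨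
    0# * (k · 0#)              ≈⟨ zeroˡ _ ⟩
    0#                         ∎

  -- In the binomial expansion every term except the first and the last has a coefficient divisible
  -- by p.
  frobenius-+ : ∀ {p} → Prime p → p · 1# ≈ 0# → ∀ x y → (x + y) ^ p ≈ x ^ p + y ^ p
  frobenius-+ {suc m} pr p≈0 x y = begin
    (x + y) ^ p                                  ≈⟨ Binomial.theorem p x y ⟩
    sum T                                        ≡⟨⟩
    T zero + sum (λ i → T (suc i))               ≈⟨ +-congˡ (sum-init-last (λ i → T (suc i))) ⟩
    T zero + (sum (λ i → T (suc (inject₁ i))) + T (suc (fromℕ m)))
      ≈⟨ +-cong T-zero (+-cong (trans (sum-cong-≋ T-mid) (sum-replicate-zero m)) T-last) ⟩
    y ^ p + (0# + x ^ p)                         ≈⟨ +-congˡ (+-identityˡ _) ⟩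
    y ^ p + x ^ p                                ≈⟨ +-comm _ _ ⟩
    x ^ p + y ^ p                                ∎
    where
    p : ℕ
    p = suc m
    T : Fin (suc p) → Carrier
    T = Binomial.binomialTerm x y p
    T-zero : T zero ≈ y ^ p
    T-zero = trans (×-homo-1 _) (*-identityˡ _)
    T-mid : ∀ i → T (suc (inject₁ i)) ≈ 0#
    T-mid i = ·-∣ _ p≈0 (≡.subst (λ k → p ∣ (p C suc k)) (≡.sym (Fin.toℕ-inject₁ i)) (prime∣choose pr (s≤s (Fin.toℕ<n i))))
    T-last : T (suc (fromℕ m)) ≈ x ^ p
    T-last rewrite Fin.toℕ-fromℕ m | nCn≡1 p | ℕ.n∸n≡0 m = trans (×-homo-1 _) (*-identityʳ _)

  frobenius-^-+ : ∀ {p} → Prime p → p · 1# ≈ 0# → ∀ k x y → (x + y) ^ (p ℕ.^ k) ≈ x ^ (p ℕ.^ k) + y ^ (p ℕ.^ k)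
  frobenius-^-+ pr p≈0 zero x y = trans (*-identityʳ _) (+-cong (sym (*-identityʳ _)) (sym (*-identityʳ _)))
  frobenius-^-+ {p} pr p≈0 (suc k) x y = begin
    (x + y) ^ (p ℕ.* P)            ≈⟨ ^-assocʳ (x + y) p P ⟨
    ((x + y) ^ p) ^ P              ≈⟨ ^-congˡ P (frobenius-+ pr p≈0 x y) ⟩
    (x ^ p + y ^ p) ^ P            ≈⟨ frobenius-^-+ pr p≈0 k (x ^ p) (y ^ p) ⟩
    (x ^ p) ^ P + (y ^ p) ^ P      ≈⟨ +-cong (^-assocʳ x p P) (^-assocʳ y p P) ⟩
    x ^ (p ℕ.* P) + y ^ (p ℕ.* P)  ∎
    where P = p ℕ.^ k

-- Characteristic and Fermat's identity in a finite field.

module FiniteField {c ℓ} (K : Fld c ℓ) {N : ℕ} (card : HasCard K N) where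
  open Fld K hiding (zero)
  open FieldProperties K
  open import Relation.Binary.Reasoning.Setoid setoid
  open import Algebra.Properties.CommutativeMonoid.Sum +-commutativeMonoid
    using (sum; sum-cong-≋; sum-permute; sum-replicate; ∑-distrib-+)
  open import Algebra.Properties.CommutativeMonoid.Sum *-commutativeMonoid
    using () renaming (sum to product; sum-cong-≋ to product-cong; sum-permute to product-permute; sum-replicate to product-replicate; ∑-distrib-+ to product-distrib-*)

  element : Fin N → Carrier
  element = proj₁ card

  element-injective : ∀ i j → element i ≈ element j → i ≡ j
  element-injective = proj₁ (proj₂ card)

  index : Carrier → Fin N
  index x = proj₁ (proj₂ (proj₂ card) x)

  element-index : ∀ x → element (index x) ≈ x
  element-index x = proj₂ (proj₂ (proj₂ card) x)

  infix 4 _≟_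
  _≟_ : ∀ x y → Dec (x ≈ y)
  x ≟ y with index x Fin.≟ index y
  ... | yes e = yes (trans (sym (element-index x)) (trans (reflexive (cong element e)) (element-index y)))
  ... | no ne = no λ x≈y → ne (element-injective _ _ (trans (element-index x) (trans x≈y (sym (element-index y)))))

  module _ (σ τ : Carrier → Carrier) (σ-cong : ∀ {x y} → x ≈ y → σ x ≈ σ y) (τ-cong : ∀ {x y} → x ≈ y → τ x ≈ τ y)
           (στ≈id : ∀ x → σ (τ x) ≈ x) (τσ≈id : ∀ x → τ (σ x) ≈ x) where

    -- Carries a bijection of the field to the indices, so that sums and products over all elements
    -- can be reordered along it.
    elementPermutation : Permutation N N
    elementPermutation = permutation (index ∘ σ ∘ element) (index ∘ τ ∘ element)
      (λ i → element-injective _ _ (trans (element-index _) (trans (σ-cong (element-index _)) (στ≈id _))))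
      (λ i → element-injective _ _ (trans (element-index _) (trans (τ-cong (element-index _)) (τσ≈id _))))

  -- Translation by 1 permutes the field, so adding 1 to every summand leaves the sum of all
  -- elements unchanged.
  N·1≈0 : N · 1# ≈ 0#
  N·1≈0 = ∙-cancelˡ (sum element) _ _ (begin
    sum element + N · 1#                        ≈⟨ +-congˡ (sum-replicate N) ⟨
    sum element + sum {N} (λ _ → 1#)            ≈⟨ ∑-distrib-+ element (λ _ → 1#) ⟨
    sum (λ i → element i + 1#)                  ≈⟨ sum-cong-≋ {N} (λ i → element-index (element i + 1#)) ⟨
    sum (λ i → element (index (element i + 1#))) ≈⟨ sum-permute element π ⟨
    sum element                                 ≈⟨ +-identityʳ _ ⟨
    sum element + 0#                            ∎)
    where
    cancel : ∀ x y z → y + z ≈ 0# → x + y + z ≈ x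
    cancel x y z e = trans (+-assoc _ _ _) (trans (+-congˡ e) (+-identityʳ x))
    π : Permutation N N
    π = elementPermutation (_+ 1#) (_- 1#) +-congʳ +-congʳ
          (λ x → cancel x _ _ (-‿inverseˡ 1#)) (λ x → cancel x _ _ (-‿inverseʳ 1#))

  -- `N · 1#` is the k-th power of `p · 1#`, and a field has no zero divisors.
  characteristic : ∀ {p k} → N ≡ p ℕ.^ k → p · 1# ≈ 0#
  characteristic {p} {k} N≡ with p · 1# ≟ 0#
  ... | yes e = e
  ... | no p≉0 = contradiction (trans (reflexive (cong (_· 1#) (≡.sym N≡))) N·1≈0) (power≉0 k)
    where
    power≉0 : ∀ k → ¬ ((p ℕ.^ k) · 1# ≈ 0#)
    power≉0 zero e = 1≉0 (trans (sym (×-homo-1 1#)) e)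
    power≉0 (suc k) e = x*y≉0 p≉0 (power≉0 k) (trans (sym (×1-homo-* p (p ℕ.^ k))) e)

  ifZero : Carrier → Carrier → Carrier → Carrier
  ifZero u v y with y ≟ 0#
  ... | yes _ = u
  ... | no _ = v

  ifZero-yes : ∀ {u v y} → y ≈ 0# → ifZero u v y ≈ u
  ifZero-yes {y = y} y≈0 with y ≟ 0#
  ... | yes _ = refl
  ... | no y≉0 = contradiction y≈0 y≉0

  ifZero-no : ∀ {u v y} → ¬ (y ≈ 0#) → ifZero u v y ≈ v
  ifZero-no {y = y} y≉0 with y ≟ 0#
  ... | yes y≈0 = contradiction y≈0 y≉0
  ... | no _ = refl

  product-single : ∀ {m} (g : Fin m → Carrier) i → (∀ j → ¬ (j ≡ i) → g j ≈ 1#) → product g ≈ g i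
  product-single {suc m} g zero g≈1 = begin
    g zero * product (λ j → g (suc j))  ≈⟨ *-congˡ (product-cong (λ j → g≈1 (suc j) λ ())) ⟩
    g zero * product {m} (λ _ → 1#)     ≈⟨ *-congˡ (trans (product-replicate m) (1^n≈1 m)) ⟩
    g zero * 1#                         ≈⟨ *-identityʳ _ ⟩
    g zero                              ∎
  product-single {suc m} g (suc i) g≈1 = begin
    g zero * product (λ j → g (suc j))  ≈⟨ *-cong (g≈1 zero λ ()) (product-single (λ j → g (suc j)) i (λ j j≢i → g≈1 (suc j) (j≢i ∘ Fin.suc-injective))) ⟩
    1# * g (suc i)                      ≈⟨ *-identityˡ _ ⟩
    g (suc i)                           ∎

  product≉0 : ∀ {m} (g : Fin m → Carrier) → (∀ i → ¬ (g i ≈ 0#)) → ¬ (product g ≈ 0#)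
  product≉0 {zero} g g≉0 = 1≉0
  product≉0 {suc m} g g≉0 = x*y≉0 (g≉0 zero) (product≉0 (λ i → g (suc i)) (λ i → g≉0 (suc i)))

  -- Multiplication by x permutes K, so it preserves the product H of the nonzero elements (with 0 replaced by 1).
  fermat : ∀ x → x ^ N ≈ x
  fermat x with x ≟ 0#
  -- 0^N = 0 requires N ≥ 1, which holds because `Fin N` contains the index of 0.
  ... | yes x≈0 = trans (^-congˡ N x≈0) (trans (0^n≈0 N (ℕ.≤-trans (s≤s z≤n) (Fin.toℕ<n (index 0#)))) (sym x≈0))
  ... | no x≉0 = begin
    x ^ N                                        ≈⟨ product-replicate N ⟨
    product {N} (λ _ → x)                        ≈⟨ product-cong (λ i → split (element i)) ⟨
    product (λ i → k′ (element i) * k (element i)) ≈⟨ product-distrib-* (k′ ∘ element) (k ∘ element) ⟩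
    product (k′ ∘ element) * product (k ∘ element) ≈⟨ *-cong k′-product k-product ⟩
    x * 1#                                       ≈⟨ *-identityʳ x ⟩
    x                                            ∎
    where
    -- The N factors x are separated: `k′` keeps the one at the element 0, `k` those at the nonzero
    -- elements. Thus x^N is x times the product of `k`, which is 1.
    h k k′ : Carrier → Carrier
    h y = ifZero 1# y y
    k = ifZero 1# x
    k′ = ifZero x 1#

    split : ∀ y → k′ y * k y ≈ x
    split y with y ≟ 0#
    ... | yes _ = *-identityʳ x
    ... | no _ = *-identityˡ x

    k′-product : product (k′ ∘ element) ≈ x
    k′-product = trans
      (product-single (k′ ∘ element) (index 0#) (λ j j≢ → ifZero-no λ e → j≢ (element-injective _ _ (trans e (sym (element-index 0#))))))
      (ifZero-yes (element-index 0#))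

    h≉0 : ∀ y → ¬ (h y ≈ 0#)
    h≉0 y with y ≟ 0#
    ... | yes _ = 1≉0
    ... | no y≉0 = y≉0

    h-cong : ∀ {y z} → y ≈ z → h y ≈ h z
    h-cong {y} {z} y≈z with y ≟ 0#
    ... | yes y≈0 = sym (ifZero-yes (trans (sym y≈z) y≈0))
    ... | no y≉0 = trans y≈z (sym (ifZero-no (y≉0 ∘ trans y≈z)))

    h-scale : ∀ y → h (x * y) ≈ h y * k y
    h-scale y with y ≟ 0#
    ... | yes y≈0 = trans (ifZero-yes (trans (*-congˡ y≈0) (zeroʳ x))) (sym (*-identityʳ 1#))
    ... | no y≉0 = trans (ifZero-no (x*y≉0 x≉0 y≉0)) (*-comm x y)

    x⁻¹ : Carrier
    x⁻¹ = proj₁ (inverse x x≉0)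

    cancel : ∀ u v y → u * v ≈ 1# → u * (v * y) ≈ y
    cancel u v y e = trans (sym (*-assoc u v y)) (trans (*-congʳ e) (*-identityˡ y))

    π : Permutation N N
    π = elementPermutation (x *_) (x⁻¹ *_) *-congˡ *-congˡ
          (λ y → cancel x x⁻¹ y (proj₂ (inverse x x≉0)))
          (λ y → cancel x⁻¹ x y (trans (*-comm _ _) (proj₂ (inverse x x≉0))))

    H : Carrier
    H = product (h ∘ element)

    k-product : product (k ∘ element) ≈ 1#
    k-product = *-cancelˡ (product≉0 (h ∘ element) (h≉0 ∘ element)) (begin
      H * product (k ∘ element)                        ≈⟨ product-distrib-* (h ∘ element) (k ∘ element) ⟨
      product (λ i → h (element i) * k (element i))    ≈⟨ product-cong (λ i → h-scale (element i)) ⟨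
      product (λ i → h (x * element i))                ≈⟨ product-cong (λ i → h-cong (element-index (x * element i))) ⟨
      product (λ i → h (element (index (x * element i)))) ≈⟨ product-permute (h ∘ element) π ⟨
      H                                                ≈⟨ *-identityʳ H ⟨
      H * 1#                                           ∎)

-- Fixed fields of the powers of the q-Frobenius.

module Inequivalence {c ℓ} (q n : ℕ) (q-primePower : IsPrimePower q) (K : Fld c ℓ) (card : HasCard K (q ℕ.^ n)) where
  open Fld K hiding (zero)
  open FieldDefs K q n
  open FieldProperties K
  open FiniteField K card
  open import Algebra.Properties.Group +-group using (inverseʳ-unique)
  open import Algebra.Solver.Ring.NaturalCoefficients.Default commutativeSemiring
  open import Relation.Binary.Reasoning.Setoid setoid

  2≤q : 2 ≤ q
  2≤q = let p , k , p-prime , 1≤k , q≡ = q-primePower in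
    ≡.subst (2 ≤_) (≡.sym q≡) (2≤m^n k (ℕ.nonTrivial⇒n>1 p {{prime⇒nonTrivial p-prime}}) 1≤k)

  instance
    q≢0 : ℕ.NonZero q
    q≢0 = ℕ.>-nonZero (ℕ.<-trans (s≤s z≤n) 2≤q)

  pow≡^ : ∀ x k → pow x k ≡ x ^ k
  pow≡^ x zero = ≡.refl
  pow≡^ x (suc k) = cong (x *_) (pow≡^ x k)

  -- The s-th power of the q-Frobenius, whose fixed field is `𝔽 s`.
  φ : ℕ → Carrier → Carrier
  φ s x = x ^ (q ℕ.^ s)

  φ⇒𝔽 : ∀ s {x} → φ s x ≈ x → 𝔽 s x
  φ⇒𝔽 s {x} e = lift (trans (reflexive (pow≡^ x (q ℕ.^ s))) e)

  𝔽⇒φ : ∀ s {x} → 𝔽 s x → φ s x ≈ x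
  𝔽⇒φ s {x} (lift e) = trans (reflexive (≡.sym (pow≡^ x (q ℕ.^ s)))) e

  φ-cong : ∀ s {x y} → x ≈ y → φ s x ≈ φ s y
  φ-cong s = ^-congˡ (q ℕ.^ s)

  φ-* : ∀ s x y → φ s (x * y) ≈ φ s x * φ s y
  φ-* s x y = ^-distrib-* x y (q ℕ.^ s)

  φ-+ : ∀ s x y → φ s (x + y) ≈ φ s x + φ s y
  φ-+ s x y = begin
    (x + y) ^ (q ℕ.^ s)                             ≈⟨ ^-congʳ (x + y) (q^≡p^ s) ⟩
    (x + y) ^ (p ℕ.^ (k ℕ.* s))                     ≈⟨ frobenius-^-+ p-prime (characteristic {p} {k ℕ.* n} (q^≡p^ n)) (k ℕ.* s) x y ⟩
    x ^ (p ℕ.^ (k ℕ.* s)) + y ^ (p ℕ.^ (k ℕ.* s))   ≈⟨ +-cong (^-congʳ x (q^≡p^ s)) (^-congʳ y (q^≡p^ s)) ⟨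
    x ^ (q ℕ.^ s) + y ^ (q ℕ.^ s)                   ∎
    where
    p k : ℕ
    p = proj₁ q-primePower
    k = proj₁ (proj₂ q-primePower)
    p-prime : Prime p
    p-prime = proj₁ (proj₂ (proj₂ q-primePower))
    q^≡p^ : ∀ s → q ℕ.^ s ≡ p ℕ.^ (k ℕ.* s)
    q^≡p^ s = ≡.trans (cong (ℕ._^ s) (proj₂ (proj₂ (proj₂ (proj₂ q-primePower))))) (ℕ.^-*-assoc p k s)

  φ-0 : ∀ s → φ s 0# ≈ 0#
  φ-0 s = 0^n≈0 (q ℕ.^ s) (ℕ.m^n>0 q s)

  φ-1 : ∀ s → φ s 1# ≈ 1#
  φ-1 s = 1^n≈1 (q ℕ.^ s)

  φ-suc : ∀ s x → φ (suc s) x ≈ φ s (φ 1 x)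
  φ-suc s x = sym (begin
    (x ^ (q ℕ.* 1)) ^ (q ℕ.^ s) ≈⟨ ^-congˡ (q ℕ.^ s) (^-congʳ x (ℕ.*-identityʳ q)) ⟩
    (x ^ q) ^ (q ℕ.^ s)         ≈⟨ ^-assocʳ x q (q ℕ.^ s) ⟩
    x ^ (q ℕ.* q ℕ.^ s)         ∎)

  𝔽-resp : ∀ s {x y} → x ≈ y → 𝔽 s x → 𝔽 s y
  𝔽-resp s x≈y x∈ = φ⇒𝔽 s (trans (φ-cong s (sym x≈y)) (trans (𝔽⇒φ s x∈) x≈y))

  𝔽-0 : ∀ s → 𝔽 s 0#
  𝔽-0 s = φ⇒𝔽 s (φ-0 s)

  𝔽-1 : ∀ s → 𝔽 s 1#
  𝔽-1 s = φ⇒𝔽 s (φ-1 s)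

  𝔽-+ : ∀ s {x y} → 𝔽 s x → 𝔽 s y → 𝔽 s (x + y)
  𝔽-+ s x∈ y∈ = φ⇒𝔽 s (trans (φ-+ s _ _) (+-cong (𝔽⇒φ s x∈) (𝔽⇒φ s y∈)))

  𝔽-* : ∀ s {x y} → 𝔽 s x → 𝔽 s y → 𝔽 s (x * y)
  𝔽-* s x∈ y∈ = φ⇒𝔽 s (trans (φ-* s _ _) (*-cong (𝔽⇒φ s x∈) (𝔽⇒φ s y∈)))

  𝔽-neg : ∀ s {x} → 𝔽 s x → 𝔽 s (- x)
  𝔽-neg s {x} x∈ = φ⇒𝔽 s (inverseʳ-unique x (φ s (- x)) (begin
    x + φ s (- x)      ≈⟨ +-congʳ (𝔽⇒φ s x∈) ⟨
    φ s x + φ s (- x)  ≈⟨ φ-+ s x (- x) ⟨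
    φ s (x - x)        ≈⟨ φ-cong s (-‿inverseʳ x) ⟩
    φ s 0#             ≈⟨ φ-0 s ⟩
    0#                 ∎))

  *≈1⇒≉0 : ∀ {x y} → x * y ≈ 1# → ¬ (x ≈ 0#)
  *≈1⇒≉0 xy≈1 x≈0 = 1≉0 (trans (sym xy≈1) (trans (*-congʳ x≈0) (zeroˡ _)))

  -- `φ s` is multiplicative and fixes x and x * y; cancelling x shows that it fixes y. This gives
  -- closure under inverses and quotients at once.
  𝔽-quotient : ∀ s {x y} → ¬ (x ≈ 0#) → 𝔽 s x → 𝔽 s (x * y) → 𝔽 s y
  𝔽-quotient s {x} {y} x≉0 x∈ xy∈ = φ⇒𝔽 s (*-cancelˡ x≉0 (begin
    x * φ s y      ≈⟨ *-congʳ (𝔽⇒φ s x∈) ⟨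
    φ s x * φ s y  ≈⟨ φ-* s x y ⟨
    φ s (x * y)    ≈⟨ 𝔽⇒φ s xy∈ ⟩
    x * y          ∎))

  𝔽-isSubfield : ∀ s → IsSubfield (𝔽 s)
  𝔽-isSubfield s = (λ _ _ → 𝔽-resp s) , 𝔽-0 s , 𝔽-1 s , (λ _ _ → 𝔽-+ s) , (λ _ → 𝔽-neg s) , (λ _ _ → 𝔽-* s)
    , λ x y x∈ xy≈1 → 𝔽-quotient s (*≈1⇒≉0 xy≈1) x∈ (𝔽-resp s (sym xy≈1) (𝔽-1 s))

  -- `φ s` is the s-fold iterate of `φ 1`, so it fixes whatever `φ 1` fixes.
  Fq⊆𝔽 : ∀ s {x} → Fq x → 𝔽 s x
  Fq⊆𝔽 s x∈ = φ⇒𝔽 s (go s)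
    where
    go : ∀ s → φ s _ ≈ _
    go zero = *-identityʳ _
    go (suc s) = trans (φ-suc s _) (trans (φ-cong s (𝔽⇒φ 1 x∈)) (go s))

  𝔽n-full : ∀ x → 𝔽 n x
  𝔽n-full x = φ⇒𝔽 n (fermat x)

  -- For x ≠ 0, multiplying (x^g)^Q by x makes `geometric-step` and Fermat's identity applicable;
  -- the result is x * x^g, and x cancels. The case x = 0 is separate because of this cancellation.
  norm∈𝔽 : ∀ t l → n ≡ t ℕ.* (l ℕ.+ 1) → ∀ x → 𝔽 t (x ^ geometric (q ℕ.^ t) l)
  norm∈𝔽 t l n≡ x with x ≟ 0#
  ... | yes x≈0 = 𝔽-resp t (sym (trans (^-congˡ g x≈0) (0^n≈0 g (1≤geometric (q ℕ.^ t) l)))) (𝔽-0 t)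
    where
    g : ℕ
    g = geometric (q ℕ.^ t) l
  ... | no x≉0 = φ⇒𝔽 t (*-cancelˡ x≉0 (begin
    x * (x ^ g) ^ Q     ≈⟨ *-congˡ (^-assocʳ x g Q) ⟩
    x ^ suc (g ℕ.* Q)   ≈⟨ ^-congʳ x (≡.trans (ℕ.+-comm 1 (g ℕ.* Q)) (geometric-step Q l)) ⟩
    x ^ (g ℕ.+ Q ℕ.^ suc l) ≈⟨ ^-homo-* x g (Q ℕ.^ suc l) ⟩
    x ^ g * x ^ (Q ℕ.^ suc l) ≈⟨ *-congˡ (^-congʳ x Q^[l+1]≡q^n) ⟩
    x ^ g * x ^ (q ℕ.^ n)     ≈⟨ *-congˡ (fermat x) ⟩
    x ^ g * x                 ≈⟨ *-comm _ _ ⟩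
    x * x ^ g                 ∎))
    where
    Q g : ℕ
    Q = q ℕ.^ t
    g = geometric Q l
    Q^[l+1]≡q^n : Q ℕ.^ suc l ≡ q ℕ.^ n
    Q^[l+1]≡q^n = ≡.trans (ℕ.^-*-assoc q t (suc l)) (cong (q ℕ.^_) (≡.trans (cong (t ℕ.*_) (ℕ.+-comm 1 l)) (≡.sym n≡)))

  𝔽-⊈ : ∀ s t l → n ≡ t ℕ.* (l ℕ.+ 1) → 1 ≤ s → s < t → ¬ (∀ x → 𝔽 t x → 𝔽 s x)
  𝔽-⊈ s t l n≡ 1≤s s<t t⊆s = ℕ.<⇒≱ (geometric*q^s<q^n q s t l 2≤q s<t)
    (≡.subst (λ m → q ℕ.^ m ≤ g ℕ.* q ℕ.^ s) n≡
      (x^a≈x^b⇒card≤a g<gq^s element element-injective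
        (λ i → let x = element i in trans (sym (^-assocʳ x g (q ℕ.^ s))) (𝔽⇒φ s (t⊆s _ (norm∈𝔽 t l n≡ x))))))
    where
    g : ℕ
    g = geometric (q ℕ.^ t) l
    -- Here s ≥ 1 keeps the exponents distinct, so X^(g q^s) - X^g is monic of degree g q^s.
    g<gq^s : g < g ℕ.* q ℕ.^ s
    g<gq^s = ℕ.m<m*n g (q ℕ.^ s) {{ℕ.>-nonZero (1≤geometric (q ℕ.^ t) l)}} (2≤m^n s 2≤q 1≤s)

  -- A subfield `𝔽 s` containing 𝔽_q and b would contain 𝔽_q(b) = `𝔽 t`.
  generator∉𝔽 : ∀ s t l {b} → n ≡ t ℕ.* (l ℕ.+ 1) → GenEq Fq b (𝔽 t) → 1 ≤ s → s < t → ¬ 𝔽 s b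
  generator∉𝔽 s t l n≡ gen 1≤s s<t b∈ = 𝔽-⊈ s t l n≡ 1≤s s<t
    λ x x∈ → proj₂ (gen x) x∈ (𝔽 s) (𝔽-isSubfield s) (λ _ → Fq⊆𝔽 s) b∈

  -- Linear independence over 𝔽_q.

  -- If z were nonzero, g = -u/z would lie in `𝔽 s`.
  affine-independence : ∀ s {u z g} → ¬ 𝔽 s g → 𝔽 s u → 𝔽 s z → u + z * g ≈ 0# → z ≈ 0# × u ≈ 0#
  affine-independence s {u} {z} {g} g∉ u∈ z∈ e with z ≟ 0#
  ... | yes z≈0 = z≈0 , (begin
    u           ≈⟨ +-identityʳ u ⟨
    u + 0#      ≈⟨ +-congˡ (trans (*-congʳ z≈0) (zeroˡ g)) ⟨
    u + z * g   ≈⟨ e ⟩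
    0#          ∎)
  ... | no z≉0 = contradiction (𝔽-quotient s z≉0 z∈ (𝔽-resp s (sym (inverseʳ-unique u (z * g) e)) (𝔽-neg s u∈))) g∉

  -- A root b of a quadratic over 𝔽_q has at most one other conjugate b^q, hence b^(q²) = b.
  quadratic-independence : ∀ {b x y z} → ¬ 𝔽 1 b → ¬ 𝔽 2 b → Fq x → Fq y → Fq z →
    x + y * b + z * (b * b) ≈ 0# → x ≈ 0# × y ≈ 0# × z ≈ 0#
  quadratic-independence {b} {x} {y} {z} b∉𝔽1 b∉𝔽2 x∈ y∈ z∈ e with z ≟ 0#
  ... | yes z≈0 with affine-independence 1 b∉𝔽1 x∈ y∈ (begin
      x + y * b                  ≈⟨ +-identityʳ _ ⟨
      x + y * b + 0#             ≈⟨ +-congˡ (trans (*-congʳ z≈0) (zeroˡ (b * b))) ⟨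
      x + y * b + z * (b * b)    ≈⟨ e ⟩
      0#                         ∎)
  ...   | y≈0 , x≈0 = x≈0 , y≈0 , z≈0
  quadratic-independence {b} {x} {y} {z} b∉𝔽1 b∉𝔽2 x∈ y∈ z∈ e | no z≉0 =
    -- Both y + z b^q + z b and y + z b^q + z b^(q²) vanish, and z ≠ 0, so b^(q²) = b.
    contradiction (φ⇒𝔽 2 (trans (φ-suc 1 b) (*-cancelˡ z≉0 (∙-cancelˡ (y + z * b′) _ _ (begin
      y + z * b′ + z * φ 1 b′   ≈⟨ regroup y z b′ (φ 1 b′) ⟩
      y + z * (φ 1 b′ + b′)     ≈⟨ φ-sum ⟩
      0#                        ≈⟨ sum≈0 ⟨
      y + z * (b′ + b)          ≈⟨ trans (+-congˡ (*-congˡ (+-comm b′ b))) (sym (regroup y z b′ b)) ⟩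
      y + z * b′ + z * b        ∎))))) b∉𝔽2
    where
    b′ : Carrier
    b′ = φ 1 b

    regroup : ∀ y z u v → y + z * u + z * v ≈ y + z * (v + u)
    regroup = solve 4 (λ y z u v → y :+ z :* u :+ z :* v := y :+ z :* (v :+ u)) refl

    conjugate : x + y * b′ + z * (b′ * b′) ≈ 0#
    conjugate = begin
      x + y * b′ + z * (b′ * b′)
        ≈⟨ +-cong (+-cong (𝔽⇒φ 1 x∈) (trans (φ-* 1 y b) (*-congʳ (𝔽⇒φ 1 y∈))))
                  (trans (φ-* 1 z (b * b)) (*-cong (𝔽⇒φ 1 z∈) (φ-* 1 b b))) ⟨
      φ 1 x + φ 1 (y * b) + φ 1 (z * (b * b))
        ≈⟨ trans (φ-+ 1 _ _) (+-congʳ (φ-+ 1 _ _)) ⟨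
      φ 1 (x + y * b + z * (b * b))
        ≈⟨ trans (φ-cong 1 e) (φ-0 1) ⟩
      0# ∎

    -- Subtracting the equation of b from that of its conjugate leaves the factor `b′ - b`, which is
    -- nonzero.
    sum≈0 : y + z * (b′ + b) ≈ 0#
    sum≈0 = x*y≈0⇒y≈0 (x-y≉0 (b∉𝔽1 ∘ φ⇒𝔽 1)) (∙-cancelˡ (x + y * b + z * (b * b)) _ _ (begin
      x + y * b + z * (b * b) + (b′ - b) * (y + z * (b′ + b))
        ≈⟨ solve 6 (λ x y z b b′ m → x :+ y :* b :+ z :* (b :* b) :+ (b′ :+ m) :* (y :+ z :* (b′ :+ b))
              := x :+ y :* b′ :+ z :* (b′ :* b′) :+ (b :+ m) :* (y :+ z :* (b′ :+ b))) refl x y z b b′ (- b) ⟩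
      x + y * b′ + z * (b′ * b′) + (b - b) * (y + z * (b′ + b))
        ≈⟨ +-cong (trans conjugate (sym e)) (trans (*-congʳ (-‿inverseʳ b)) (zeroˡ _)) ⟩
      x + y * b + z * (b * b) + 0# ∎))

    φ-sum : y + z * (φ 1 b′ + b′) ≈ 0#
    φ-sum = begin
      y + z * (φ 1 b′ + b′)         ≈⟨ +-cong (𝔽⇒φ 1 y∈) (*-cong (𝔽⇒φ 1 z∈) (φ-+ 1 b′ b)) ⟨
      φ 1 y + φ 1 z * φ 1 (b′ + b)  ≈⟨ +-congˡ (φ-* 1 z _) ⟨
      φ 1 y + φ 1 (z * (b′ + b))    ≈⟨ φ-+ 1 y _ ⟨
      φ 1 (y + z * (b′ + b))        ≈⟨ trans (φ-cong 1 sum≈0) (φ-0 1) ⟩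
      0#                            ∎

  Independent₃ : Carrier → Carrier → Carrier → Set (c ⊔ ℓ)
  Independent₃ τ₀ τ₁ τ₂ = ∀ x y z → Fq x → Fq y → Fq z →
    x * τ₀ + y * τ₁ + z * τ₂ ≈ 0# → x ≈ 0# × y ≈ 0# × z ≈ 0#

  In⟨1,_⟩ : Carrier → Carrier → Set (c ⊔ ℓ)
  In⟨1, b ⟩ v = Σ Carrier λ α → Σ Carrier λ β → Fq α × Fq β × v ≈ α + β * b

  -- If the cross product of the coordinate vectors is zero, these are parallel and
  -- (α₁, -α₀, 0), (β₁, -β₀, 0) are relations.
  ⟨1,b⟩-dependent : ∀ {b w₀ w₁ w₂} → In⟨1, b ⟩ w₀ → In⟨1, b ⟩ w₁ → In⟨1, b ⟩ w₂ → ¬ Independent₃ w₀ w₁ w₂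
  ⟨1,b⟩-dependent {b} {w₀} {w₁} {w₂} (α₀ , β₀ , α₀∈ , β₀∈ , w₀≈) (α₁ , β₁ , α₁∈ , β₁∈ , w₁≈) (α₂ , β₂ , α₂∈ , β₂∈ , w₂≈) indep =
    -- Once α₀ = β₀ = 0, w₀ is zero and (1, 0, 0) is a nontrivial relation.
    1≉0 (proj₁ (indep 1# 0# 0# (𝔽-1 1) (𝔽-0 1) (𝔽-0 1) (begin
      1# * w₀ + 0# * w₁ + 0# * w₂  ≈⟨ solve 3 (λ a b c → con 1 :* a :+ con 0 :* b :+ con 0 :* c := a) refl w₀ w₁ w₂ ⟩
      w₀                           ≈⟨ w₀≈ ⟩
      α₀ + β₀ * b                  ≈⟨ +-cong α₀≈0 (trans (*-congʳ β₀≈0) (zeroˡ b)) ⟩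
      0# + 0#                      ≈⟨ +-identityˡ 0# ⟩
      0#                           ∎)))
    where
    -- -1 is treated as an indeterminate `m`, so that the cancellations below become multiples of
    -- `1# + m`.
    m : Carrier
    m = - 1#

    m∈ : Fq m
    m∈ = 𝔽-neg 1 (𝔽-1 1)

    [1+m]x≈0 : ∀ x → (1# + m) * x ≈ 0#
    [1+m]x≈0 x = trans (*-congʳ (-‿inverseʳ 1#)) (zeroˡ x)

    det∈ : ∀ {a b c d} → Fq a → Fq b → Fq c → Fq d → Fq (a * b + m * (c * d))
    det∈ a∈ b∈ c∈ d∈ = 𝔽-+ 1 (𝔽-* 1 a∈ b∈) (𝔽-* 1 m∈ (𝔽-* 1 c∈ d∈))

    -- The cross product of the α's and the β's is orthogonal to both, hence gives a relation among
    -- the w's; by independence its entries vanish.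
    det₂≈0 : α₀ * β₁ + m * (α₁ * β₀) ≈ 0#
    det₂≈0 = proj₂ (proj₂ (indep (α₁ * β₂ + m * (α₂ * β₁)) (α₂ * β₀ + m * (α₀ * β₂)) (α₀ * β₁ + m * (α₁ * β₀))
      (det∈ α₁∈ β₂∈ α₂∈ β₁∈) (det∈ α₂∈ β₀∈ α₀∈ β₂∈) (det∈ α₀∈ β₁∈ α₁∈ β₀∈)
      (begin
        _ ≈⟨ +-cong (+-cong (*-congˡ w₀≈) (*-congˡ w₁≈)) (*-congˡ w₂≈) ⟩
        _ ≈⟨ solve 8 (λ α₀ β₀ α₁ β₁ α₂ β₂ b m →
               (α₁ :* β₂ :+ m :* (α₂ :* β₁)) :* (α₀ :+ β₀ :* b)
               :+ (α₂ :* β₀ :+ m :* (α₀ :* β₂)) :* (α₁ :+ β₁ :* b)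
               :+ (α₀ :* β₁ :+ m :* (α₁ :* β₀)) :* (α₂ :+ β₂ :* b)
               := (con 1 :+ m) :* (α₀ :* α₁ :* β₂ :+ α₁ :* α₂ :* β₀ :+ α₀ :* α₂ :* β₁
                    :+ (β₀ :* β₂ :* α₁ :+ β₀ :* β₁ :* α₂ :+ β₁ :* β₂ :* α₀) :* b))
               refl α₀ β₀ α₁ β₁ α₂ β₂ b m ⟩
        _ ≈⟨ [1+m]x≈0 _ ⟩
        0# ∎)))

    parallel : ∀ {x y} → x * α₁ + y * α₀ ≈ 0# → x * β₁ + y * β₀ ≈ 0# → x * w₁ + y * w₀ ≈ 0#
    parallel {x} {y} eα eβ = begin
      x * w₁ + y * w₀                            ≈⟨ +-cong (*-congˡ w₁≈) (*-congˡ w₀≈) ⟩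
      x * (α₁ + β₁ * b) + y * (α₀ + β₀ * b)
        ≈⟨ solve 7 (λ x y α₀ β₀ α₁ β₁ b → x :* (α₁ :+ β₁ :* b) :+ y :* (α₀ :+ β₀ :* b)
             := (x :* α₁ :+ y :* α₀) :+ (x :* β₁ :+ y :* β₀) :* b) refl x y α₀ β₀ α₁ β₁ b ⟩
      (x * α₁ + y * α₀) + (x * β₁ + y * β₀) * b  ≈⟨ +-cong eα (trans (*-congʳ eβ) (zeroˡ b)) ⟩
      0# + 0#                                    ≈⟨ +-identityˡ 0# ⟩
      0#                                         ∎

    second-vanishes : ∀ {x y} → Fq x → Fq y → x * w₁ + y * w₀ ≈ 0# → x ≈ 0#
    second-vanishes {x} {y} x∈ y∈ e = proj₁ (proj₂ (indep y x 0# y∈ x∈ (𝔽-0 1) (begin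
      y * w₀ + x * w₁ + 0# * w₂  ≈⟨ solve 5 (λ y x a b c → y :* a :+ x :* b :+ con 0 :* c := x :* b :+ y :* a) refl y x w₀ w₁ w₂ ⟩
      x * w₁ + y * w₀            ≈⟨ e ⟩
      0#                         ∎)))

    α₀≈0 : α₀ ≈ 0#
    α₀≈0 = second-vanishes α₀∈ (𝔽-* 1 m∈ α₁∈) (parallel
      (trans (solve 3 (λ m a b → a :* b :+ m :* b :* a := (con 1 :+ m) :* (a :* b)) refl m α₀ α₁)
             ([1+m]x≈0 _))
      (trans (+-congˡ (*-assoc m α₁ β₀)) det₂≈0))

    β₀≈0 : β₀ ≈ 0#
    β₀≈0 = x*y≈0⇒y≈0 m≉0 (second-vanishes (𝔽-* 1 m∈ β₀∈) β₁∈ (parallel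
      (trans (solve 5 (λ m α₀ β₀ α₁ β₁ → m :* β₀ :* α₁ :+ β₁ :* α₀ := α₀ :* β₁ :+ m :* (α₁ :* β₀)) refl m α₀ β₀ α₁ β₁) det₂≈0)
      (trans (solve 3 (λ m a b → m :* a :* b :+ b :* a := (con 1 :+ m) :* (a :* b)) refl m β₀ β₁)
             ([1+m]x≈0 _))))
      where
      m≉0 : ¬ (m ≈ 0#)
      m≉0 m≈0 = 1≉0 (trans (sym (+-identityʳ 1#)) (trans (+-congˡ (sym m≈0)) (-‿inverseʳ 1#)))

  -- Field automorphisms and independence.

  module Semilinear {ρ : Carrier → Carrier} (ρ-aut : IsAut ρ) where
    ρ-cong : ∀ {x y} → x ≈ y → ρ x ≈ ρ y
    ρ-cong = proj₁ ρ-aut _ _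

    ρ-+ : ∀ x y → ρ (x + y) ≈ ρ x + ρ y
    ρ-+ = proj₁ (proj₂ ρ-aut)

    ρ-* : ∀ x y → ρ (x * y) ≈ ρ x * ρ y
    ρ-* = proj₁ (proj₂ (proj₂ ρ-aut))

    ρ-1 : ρ 1# ≈ 1#
    ρ-1 = proj₁ (proj₂ (proj₂ (proj₂ ρ-aut)))

    ρ-injective : ∀ {x y} → ρ x ≈ ρ y → x ≈ y
    ρ-injective = proj₁ (proj₂ (proj₂ (proj₂ (proj₂ ρ-aut)))) _ _

    ρ-surjective : ∀ y → Σ Carrier λ x → ρ x ≈ y
    ρ-surjective = proj₂ (proj₂ (proj₂ (proj₂ (proj₂ ρ-aut))))

    ρ-0 : ρ 0# ≈ 0#
    ρ-0 = ∙-cancelˡ (ρ 0#) _ _ (begin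
      ρ 0# + ρ 0#  ≈⟨ ρ-+ 0# 0# ⟨
      ρ (0# + 0#)  ≈⟨ ρ-cong (+-identityˡ 0#) ⟩
      ρ 0#         ≈⟨ +-identityʳ _ ⟨
      ρ 0# + 0#    ∎)

    ρ-^ : ∀ x k → ρ (x ^ k) ≈ ρ x ^ k
    ρ-^ x zero = ρ-1
    ρ-^ x (suc k) = trans (ρ-* x (x ^ k)) (*-congˡ (ρ-^ x k))

    -- An automorphism commutes with powers, hence with `φ s`, and so preserves its fixed field.
    ρ-𝔽 : ∀ s {x} → 𝔽 s x → 𝔽 s (ρ x)
    ρ-𝔽 s x∈ = φ⇒𝔽 s (trans (sym (ρ-^ _ (q ℕ.^ s))) (ρ-cong (𝔽⇒φ s x∈)))

    ρ-𝔽⁻¹ : ∀ s {x} → 𝔽 s (ρ x) → 𝔽 s x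
    ρ-𝔽⁻¹ s ρx∈ = φ⇒𝔽 s (ρ-injective (trans (ρ-^ _ (q ℕ.^ s)) (𝔽⇒φ s ρx∈)))

    -- Since ρ permutes 𝔽_q, the coefficients of a relation among the images are ρ of elements of
    -- 𝔽_q. Cancelling μ and undoing ρ gives a relation among the original elements.
    independent-image : ∀ {μ τ₀ τ₁ τ₂} → ¬ (μ ≈ 0#) → Independent₃ τ₀ τ₁ τ₂ →
      Independent₃ (μ * ρ τ₀) (μ * ρ τ₁) (μ * ρ τ₂)
    independent-image {μ} {τ₀} {τ₁} {τ₂} μ≉0 indep x y z x∈ y∈ z∈ e =
      vanish x x≈ (proj₁ xyz≈0) , vanish y y≈ (proj₁ (proj₂ xyz≈0)) , vanish z z≈ (proj₂ (proj₂ xyz≈0))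
      where
      x′ y′ z′ : Carrier
      x′ = proj₁ (ρ-surjective x)
      y′ = proj₁ (ρ-surjective y)
      z′ = proj₁ (ρ-surjective z)

      x≈ : ρ x′ ≈ x
      x≈ = proj₂ (ρ-surjective x)
      y≈ : ρ y′ ≈ y
      y≈ = proj₂ (ρ-surjective y)
      z≈ : ρ z′ ≈ z
      z≈ = proj₂ (ρ-surjective z)

      preimage∈ : ∀ {u v} → ρ u ≈ v → Fq v → Fq u
      preimage∈ e v∈ = ρ-𝔽⁻¹ 1 (𝔽-resp 1 (sym e) v∈)

      vanish : ∀ {u} v → ρ u ≈ v → u ≈ 0# → v ≈ 0#
      vanish v e u≈0 = trans (sym e) (trans (ρ-cong u≈0) ρ-0)

      ρ-term : ∀ {u v} τ → ρ u ≈ v → ρ (u * τ) ≈ v * ρ τ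
      ρ-term τ e = trans (ρ-* _ τ) (*-congʳ e)

      xyz≈0 : x′ ≈ 0# × y′ ≈ 0# × z′ ≈ 0#
      xyz≈0 = indep x′ y′ z′ (preimage∈ x≈ x∈) (preimage∈ y≈ y∈) (preimage∈ z≈ z∈)
        (ρ-injective (trans (x*y≈0⇒y≈0 μ≉0 (begin
          μ * ρ (x′ * τ₀ + y′ * τ₁ + z′ * τ₂)
            ≈⟨ *-congˡ (trans (ρ-+ _ _) (+-cong (trans (ρ-+ _ _) (+-cong (ρ-term τ₀ x≈) (ρ-term τ₁ y≈))) (ρ-term τ₂ z≈))) ⟩
          μ * (x * ρ τ₀ + y * ρ τ₁ + z * ρ τ₂)
            ≈⟨ solve 7 (λ μ x y z a b c → μ :* (x :* a :+ y :* b :+ z :* c) := x :* (μ :* a) :+ y :* (μ :* b) :+ z :* (μ :* c))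
                 refl μ x y z (ρ τ₀) (ρ τ₁) (ρ τ₂) ⟩
          x * (μ * ρ τ₀) + y * (μ * ρ τ₁) + z * (μ * ρ τ₂)
            ≈⟨ e ⟩
          0# ∎)) (sym ρ-0)))

  -- The features shared by U₁, U₂, U₃ (with t = n, t, 2): the point ⟨(1,0)⟩ has weight at least 3,
  -- and the second coordinates range over ⟨1, b⟩.
  record Shape (U : Sub2) (t : ℕ) (b : Carrier) : Set (Level.suc (c ⊔ ℓ)) where
    field
      codegree : ℕ
      n≡ : n ≡ t ℕ.* (codegree ℕ.+ 1)
      generates : GenEq Fq b (𝔽 t)
      second : ∀ {u v} → U (u , v) → In⟨1, b ⟩ v
      -- With 1 and b among the second coordinates, b is recovered as a quotient even after scaling.
      has-1 : Σ Carrier λ u → U (u , 1#)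
      has-b : Σ Carrier λ u → U (u , b)
      {τ₀ τ₁ τ₂} : Carrier
      has-τ₀ : U (τ₀ , 0#)
      has-τ₁ : U (τ₁ , 0#)
      has-τ₂ : U (τ₂ , 0#)
      independent : Independent₃ τ₀ τ₁ τ₂

    b∈𝔽 : 𝔽 t b
    b∈𝔽 = proj₁ (generates b) (λ _ _ _ Pb → Pb)

    second∈𝔽 : ∀ s {u v} → 𝔽 s b → U (u , v) → 𝔽 s v
    second∈𝔽 s b∈ uv∈ with second uv∈
    ... | α , β , α∈ , β∈ , v≈ = 𝔽-resp s (sym v≈) (𝔽-+ s (Fq⊆𝔽 s α∈) (𝔽-* s (Fq⊆𝔽 s β∈) b∈))

  -- Equivalences between subspaces of this shape.

  module _ {U U′ t t′ b b′} (shape : Shape U t b) (shape′ : Shape U′ t′ b′) (equiv : ΓLEquiv U U′) where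
    private
      module S = Shape shape
      module S′ = Shape shape′

      m₁₁ m₁₂ m₂₁ m₂₂ : Carrier
      m₁₁ = proj₁ equiv
      m₁₂ = proj₁ (proj₂ equiv)
      m₂₁ = proj₁ (proj₂ (proj₂ equiv))
      m₂₂ = proj₁ (proj₂ (proj₂ (proj₂ equiv)))

      ρ : Carrier → Carrier
      ρ = proj₁ (proj₂ (proj₂ (proj₂ (proj₂ equiv))))

      det≉0 : ¬ (m₁₁ * m₂₂ - m₁₂ * m₂₁ ≈ 0#)
      det≉0 = proj₁ (proj₂ (proj₂ (proj₂ (proj₂ (proj₂ equiv)))))

      open Semilinear (proj₁ (proj₂ (proj₂ (proj₂ (proj₂ (proj₂ (proj₂ equiv)))))))

      maps : ∀ u v → (U′ (u , v) → Σ Carrier λ x → Σ Carrier λ y → (U (x , y) × u ≈ m₁₁ * ρ x + m₁₂ * ρ y × v ≈ m₂₁ * ρ x + m₂₂ * ρ y))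
                   × ((Σ Carrier λ x → Σ Carrier λ y → (U (x , y) × u ≈ m₁₁ * ρ x + m₁₂ * ρ y × v ≈ m₂₁ * ρ x + m₂₂ * ρ y)) → U′ (u , v))
      maps = proj₂ (proj₂ (proj₂ (proj₂ (proj₂ (proj₂ (proj₂ equiv))))))

      image : ∀ {x y} → U (x , y) → U′ (m₁₁ * ρ x + m₁₂ * ρ y , m₂₁ * ρ x + m₂₂ * ρ y)
      image xy∈ = proj₂ (maps _ _) (_ , _ , xy∈ , refl , refl)

      -- Points other than ⟨(1,0)⟩ have weight at most 2, so ⟨(1,0)⟩ is fixed.
      m₂₁≈0 : m₂₁ ≈ 0#
      m₂₁≈0 with m₂₁ ≟ 0#
      ... | yes e = e
      ... | no m₂₁≉0 = contradiction (independent-image m₂₁≉0 S.independent)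
                         (⟨1,b⟩-dependent (second-image S.has-τ₀) (second-image S.has-τ₁) (second-image S.has-τ₂))
        where
        second-image : ∀ {τ} → U (τ , 0#) → In⟨1, b′ ⟩ (m₂₁ * ρ τ)
        second-image {τ} τ∈ with S′.second (image τ∈)
        ... | α , β , α∈ , β∈ , v≈ = α , β , α∈ , β∈ , (begin
          m₂₁ * ρ τ               ≈⟨ +-identityʳ _ ⟨
          m₂₁ * ρ τ + 0#          ≈⟨ +-congˡ (trans (*-congˡ ρ-0) (zeroʳ m₂₂)) ⟨
          m₂₁ * ρ τ + m₂₂ * ρ 0#  ≈⟨ v≈ ⟩
          α + β * b′              ∎)

      second-coordinate : ∀ x y → m₂₁ * ρ x + m₂₂ * ρ y ≈ m₂₂ * ρ y
      second-coordinate x y = trans (+-congʳ (trans (*-congʳ m₂₁≈0) (zeroˡ _))) (+-identityˡ _)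

      m₂₂≉0 : ¬ (m₂₂ ≈ 0#)
      m₂₂≉0 m₂₂≈0 = det≉0 (begin
        m₁₁ * m₂₂ - m₁₂ * m₂₁  ≈⟨ +-cong (*-congˡ m₂₂≈0) (-‿cong (*-congˡ m₂₁≈0)) ⟩
        m₁₁ * 0# - m₁₂ * 0#    ≈⟨ +-cong (zeroʳ _) (-‿cong (zeroʳ _)) ⟩
        0# - 0#                ≈⟨ -‿inverseʳ 0# ⟩
        0#                     ∎)

    -- The images of vectors with second coordinates 1 and b have second coordinates `m₂₂` and
    -- `m₂₂ * ρ b`, both in `𝔽 s`. Their quotient ρ b then lies in `𝔽 s`, and so does b.
    generator-pullback : ∀ s → 𝔽 s b′ → 𝔽 s b
    generator-pullback s b′∈ = ρ-𝔽⁻¹ s (𝔽-quotient s m₂₂≉0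
      (𝔽-resp s (trans (*-congˡ ρ-1) (*-identityʳ m₂₂)) (m₂₂*ρ∈ (proj₂ S.has-1)))
      (m₂₂*ρ∈ (proj₂ S.has-b)))
      where
      m₂₂*ρ∈ : ∀ {x y} → U (x , y) → 𝔽 s (m₂₂ * ρ y)
      m₂₂*ρ∈ xy∈ = 𝔽-resp s (second-coordinate _ _) (S′.second∈𝔽 s b′∈ (image xy∈))

    -- The vectors of U′ with second coordinates 1 and b′ have preimages, so 1 = `m₂₂ * w` and b′ =
    -- `m₂₂ * w′` with w, w′ in `𝔽 s`; hence b′ = w′/w.
    generator-pushforward : ∀ s → 𝔽 s b → 𝔽 s b′
    generator-pushforward s b∈ with preimage (proj₂ S′.has-1) | preimage (proj₂ S′.has-b)
      where
      preimage : ∀ {u v} → U′ (u , v) → Σ Carrier λ w → 𝔽 s w × v ≈ m₂₂ * w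
      preimage uv∈ with proj₁ (maps _ _) uv∈
      ... | x , y , xy∈ , _ , v≈ = ρ y , ρ-𝔽 s (S.second∈𝔽 s b∈ xy∈) , trans v≈ (second-coordinate x y)
    ... | w , w∈ , 1≈m₂₂w | w′ , w′∈ , b′≈m₂₂w′ = 𝔽-resp s (sym b′≈m₂₂w′) (𝔽-* s m₂₂∈ w′∈)
      where
      wm₂₂≈1 : w * m₂₂ ≈ 1#
      wm₂₂≈1 = trans (*-comm w m₂₂) (sym 1≈m₂₂w)
      m₂₂∈ : 𝔽 s m₂₂
      m₂₂∈ = 𝔽-quotient s (*≈1⇒≉0 wm₂₂≈1) w∈ (𝔽-resp s (sym wm₂₂≈1) (𝔽-1 s))

  -- The generator of the smaller field lies in `𝔽 s`, the other one does not. Pulling back and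
  -- pushing forward treat the two directions without inverting a semilinear map.
  inequivalent : ∀ {U U′ s t b b′} → 1 ≤ s → s < t → Shape U t b → Shape U′ s b′ → ¬ ΓLEquiv U U′ × ¬ ΓLEquiv U′ U
  inequivalent {s = s} {t} {b} 1≤s s<t shape shape′ =
      (λ e → b∉ (generator-pullback shape shape′ e s (Shape.b∈𝔽 shape′)))
    , (λ e → b∉ (generator-pushforward shape′ shape e s (Shape.b∈𝔽 shape′)))
    where
    b∉ : ¬ 𝔽 s b
    b∉ = generator∉𝔽 s t (Shape.codegree shape) (Shape.n≡ shape) (Shape.generates shape) 1≤s s<t

  -- The three families as instances of `Shape`.

  δ : ∀ {k} → Fin k → Carrier → Fin k → Carrier
  δ zero y zero = y
  δ zero y (suc i) = 0#
  δ (suc j) y zero = 0#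
  δ (suc j) y (suc i) = δ j y i

  δ-diagonal : ∀ {k} (j : Fin k) y → δ j y j ≡ y
  δ-diagonal zero y = ≡.refl
  δ-diagonal (suc j) y = δ-diagonal j y

  δ-𝔽 : ∀ s {k} (j : Fin k) {y} → 𝔽 s y → ∀ i → 𝔽 s (δ j y i)
  δ-𝔽 s zero y∈ zero = y∈
  δ-𝔽 s zero y∈ (suc i) = 𝔽-0 s
  δ-𝔽 s (suc j) y∈ zero = 𝔽-0 s
  δ-𝔽 s (suc j) y∈ (suc i) = δ-𝔽 s j y∈ i

  sumF-0 : ∀ k {f : Fin k → Carrier} → (∀ i → f i ≈ 0#) → sumF k f ≈ 0#
  sumF-0 zero f≈0 = refl
  sumF-0 (suc k) f≈0 = trans (+-cong (f≈0 zero) (sumF-0 k (f≈0 ∘ suc))) (+-identityˡ 0#)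

  -- A general `F` vanishing at 0 covers both the sums of monomials and the 𝔽_{q^t}-combinations of
  -- a basis of S.
  sumF-δ : ∀ {k} (F : Fin k → Carrier → Carrier) → (∀ i → F i 0# ≈ 0#) → ∀ j y → sumF k (λ i → F i (δ j y i)) ≈ F j y
  sumF-δ {suc k} F F0≈0 zero y = trans (+-congˡ (sumF-0 k (F0≈0 ∘ suc))) (+-identityʳ _)
  sumF-δ {suc k} F F0≈0 (suc j) y = trans (+-cong (F0≈0 zero) (sumF-δ (F ∘ suc) (F0≈0 ∘ suc) j y)) (+-identityˡ _)

  c*0*y≈0 : ∀ cc y → cc * 0# * y ≈ 0#
  c*0*y≈0 cc y = trans (*-congʳ (zeroʳ cc)) (zeroˡ y)

  sumF-monomial : ∀ {k d} cc g (d<k : d < k) y →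
    sumF k (λ i → cc * δ (fromℕ< d<k) y i * pow g (toℕ i)) ≈ cc * y * pow g d
  sumF-monomial {k} {d} cc g d<k y = trans
    (sumF-δ (λ i x → cc * x * pow g (toℕ i)) (λ i → c*0*y≈0 cc _) (fromℕ< d<k) y)
    (*-congˡ (reflexive (cong (pow g) (Fin.toℕ-fromℕ< d<k))))

  u≈u+0+0*a : ∀ u a → u ≈ u + 0# + 0# * a
  u≈u+0+0*a = solve 2 (λ u a → u := u :+ con 0 :+ con 0 :* a) refl

  0≈0+0*b : ∀ b → 0# ≈ 0# + 0# * b
  0≈0+0*b = solve 1 (λ b → con 0 := con 0 :+ con 0 :* b) refl

  1≈1+0*b : ∀ b → 1# ≈ 1# + 0# * b
  1≈1+0*b = solve 1 (λ b → con 1 := con 1 :+ con 0 :* b) refl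

  b≈0+1*b : ∀ b → b ≈ 0# + 1# * b
  b≈0+1*b = solve 1 (λ b → b := con 0 :+ con 1 :* b) refl

  independent-scale : ∀ {cc g h} → ¬ (cc ≈ 0#) → Independent₃ 1# g h → Independent₃ cc (cc * g) (cc * h)
  independent-scale {cc} {g} {h} cc≉0 indep x y z x∈ y∈ z∈ e = indep x y z x∈ y∈ z∈ (x*y≈0⇒y≈0 cc≉0 (begin
    cc * (x * 1# + y * g + z * h)        ≈⟨ solve 6 (λ c x y z g h → c :* (x :* con 1 :+ y :* g :+ z :* h) := x :* c :+ y :* (c :* g) :+ z :* (c :* h)) refl cc x y z g h ⟩
    x * cc + y * (cc * g) + z * (cc * h) ≈⟨ e ⟩
    0#                                   ∎))

  -- From t ≥ 3 it follows that b lies in neither `𝔽 1` nor `𝔽 2`, so it satisfies no nontrivial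
  -- quadratic equation over 𝔽_q.
  independent-1,b,b² : ∀ t l {b} → n ≡ t ℕ.* (l ℕ.+ 1) → 3 ≤ t → GenEq Fq b (𝔽 t) → Independent₃ 1# b (b * b)
  independent-1,b,b² t l n≡ 3≤t gen x y z x∈ y∈ z∈ e = quadratic-independence
    (generator∉𝔽 1 t l n≡ gen (s≤s z≤n) (ℕ.≤-trans (s≤s (s≤s z≤n)) 3≤t))
    (generator∉𝔽 2 t l n≡ gen (s≤s z≤n) 3≤t)
    x∈ y∈ z∈ (trans (+-congʳ (+-congʳ (sym (*-identityʳ x)))) e)

  n≡n*1 : n ≡ n ℕ.* (0 ℕ.+ 1)
  n≡n*1 = ≡.sym (ℕ.*-identityʳ n)

  -- The three independent vectors are c, cb and cb²; the exponents 0, 1, 2 are available because n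
  -- - 2 ≥ 3.
  shape₁ : ∀ {a b cc} → 5 ≤ n → Hyp₁ a b cc → Shape (U₁ a b cc) n b
  shape₁ {a} {b} {cc} 5≤n (_ , _ , cc≉0 , gen , _) = record
    { codegree = 0
    ; n≡ = n≡n*1
    ; generates = gen-n
    ; second = λ { (_ , α , β , _ , α∈ , β∈ , _ , v≈) → α , β , α∈ , β∈ , v≈ }
    ; has-1 = _ , (λ _ → 0#) , 1# , 0# , (λ _ → 𝔽-0 1) , 𝔽-1 1 , 𝔽-0 1 , refl , 1≈1+0*b b
    ; has-b = _ , (λ _ → 0#) , 0# , 1# , (λ _ → 𝔽-0 1) , 𝔽-0 1 , 𝔽-1 1 , refl , b≈0+1*b b
    ; has-τ₀ = member (ℕ.≤-trans (s≤s z≤n) 3≤n∸2) (solve 1 (λ c → c := c :* con 1 :* con 1) refl cc)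
    ; has-τ₁ = member (ℕ.≤-trans (s≤s (s≤s z≤n)) 3≤n∸2) (solve 2 (λ c b → c :* b := c :* con 1 :* (b :* con 1)) refl cc b)
    ; has-τ₂ = member 3≤n∸2 (solve 2 (λ c b → c :* (b :* b) := c :* con 1 :* (b :* (b :* con 1))) refl cc b)
    ; independent = independent-scale cc≉0 (independent-1,b,b² n 0 n≡n*1 (ℕ.≤-trans (s≤s (s≤s (s≤s z≤n))) 5≤n) gen-n)
    }
    where
    gen-n : GenEq Fq b (𝔽 n)
    -- By Fermat's identity `𝔽 n` is all of K.
    gen-n x = (λ _ → 𝔽n-full x) , (λ _ → proj₂ (gen x) tt)

    3≤n∸2 : 3 ≤ n ℕ.∸ 2
    3≤n∸2 = ℕ.∸-monoˡ-≤ 2 5≤n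

    member : ∀ {d u} → d < n ℕ.∸ 2 → u ≈ cc * 1# * pow b d → U₁ a b cc (u , 0#)
    member d< u≈ = δ (fromℕ< d<) 1# , 0# , 0# , δ-𝔽 1 (fromℕ< d<) (𝔽-1 1) , 𝔽-0 1 , 𝔽-0 1
      , trans u≈ (trans (sym (sumF-monomial cc b d< 1#)) (u≈u+0+0*a _ a)) , 0≈0+0*b b

  -- The polynomial part has only t - 2 terms, possibly one, so the three vectors are taken in S
  -- instead: s₀, s₀b and s₀b² for a basis vector s₀ of this 𝔽_{q^t}-space.
  shape₂ : ∀ {t l S a b cc} → Hyp₂ t l S a b cc → Shape (U₂ t S a b cc) t b
  shape₂ {t} {l} {S} {a} {b} {cc} (lift (n≡ , 1≤l , 3≤t , _) , _ , _ , _ , gen , (s , s-indep , S≐) , _) = record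
    { codegree = l
    ; n≡ = n≡
    ; generates = gen
    ; second = λ { (_ , _ , α , β , _ , _ , α∈ , β∈ , _ , v≈) → α , β , α∈ , β∈ , v≈ }
    ; has-1 = _ , s₀ , (λ _ → 0#) , 1# , 0# , s₀∈ , (λ _ → 𝔽-0 1) , 𝔽-1 1 , 𝔽-0 1 , refl , 1≈1+0*b b
    ; has-b = _ , s₀ , (λ _ → 0#) , 0# , 1# , s₀∈ , (λ _ → 𝔽-0 1) , 𝔽-0 1 , 𝔽-1 1 , refl , b≈0+1*b b
    ; has-τ₀ = member s₀∈
    ; has-τ₁ = member (multiple b∈ refl)
    ; has-τ₂ = member (multiple (𝔽-* t b∈ b∈) refl)
    ; independent = independent-scale s₀≉0 (independent-1,b,b² t l n≡ 3≤t gen)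
    }
    where
    j : Fin l
    j = fromℕ< 1≤l

    s₀ : Carrier
    s₀ = s j

    b∈ : 𝔽 t b
    b∈ = proj₁ (gen b) (λ _ _ _ Pb → Pb)

    sum-δ : ∀ y → sumF l (λ i → δ j y i * s i) ≈ y * s₀
    sum-δ = sumF-δ (λ i x → x * s i) (λ i → zeroˡ (s i)) j

    multiple : ∀ {y u} → 𝔽 t y → u ≈ s₀ * y → S u
    multiple {y} y∈ u≈ = proj₂ (S≐ _) (δ j y , δ-𝔽 t j y∈ , trans u≈ (trans (*-comm s₀ y) (sym (sum-δ y))))

    s₀∈ : S s₀
    s₀∈ = multiple (𝔽-1 t) (sym (*-identityʳ s₀))

    s₀≉0 : ¬ (s₀ ≈ 0#)
    s₀≉0 s₀≈0 = 1≉0 (trans (reflexive (≡.sym (δ-diagonal j 1#)))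
      (s-indep (δ j 1#) (δ-𝔽 t j (𝔽-1 t)) (trans (sum-δ 1#) (trans (*-identityˡ s₀) s₀≈0)) j))

    member : ∀ {u} → S u → U₂ t S a b cc (u , 0#)
    member {u} u∈ = u , (λ _ → 0#) , 0# , 0# , u∈ , (λ _ → 𝔽-0 1) , 𝔽-0 1 , 𝔽-0 1
      , (begin
           u                 ≈⟨ u≈u+0+0*a u a ⟩
           u + 0# + 0# * a   ≈⟨ +-congʳ (+-congʳ (trans (+-congˡ (sumF-0 (t ℕ.∸ 2) (λ i → c*0*y≈0 cc _))) (+-identityʳ u))) ⟨
           _                 ∎)
      , 0≈0+0*b b

  -- The three vectors are c, cb and cγ: 1 and b are coefficients from `𝔽 2` at γ⁰, and γ¹ is
  -- available since n = 2m ≥ 5 gives m - 1 ≥ 2.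
  shape₃ : ∀ m {a b cc γ} → 5 ≤ n → Hyp₃ m a b cc γ → Shape (U₃ m a b cc γ) 2 b
  shape₃ m {a} {b} {cc} {γ} 5≤n (lift n≡2m , _ , _ , cc≉0 , _ , gen , genγ , _) = record
    { codegree = m ℕ.∸ 1
    ; n≡ = n≡
    ; generates = gen
    ; second = λ { (_ , α , β , _ , α∈ , β∈ , _ , v≈) → α , β , α∈ , β∈ , v≈ }
    ; has-1 = _ , (λ _ → 0#) , 1# , 0# , (λ _ → 𝔽-0 2) , 𝔽-1 1 , 𝔽-0 1 , refl , 1≈1+0*b b
    ; has-b = _ , (λ _ → 0#) , 0# , 1# , (λ _ → 𝔽-0 2) , 𝔽-0 1 , 𝔽-1 1 , refl , b≈0+1*b b
    ; has-τ₀ = member (ℕ.≤-trans (s≤s z≤n) 2≤m∸1) (𝔽-1 2) (solve 1 (λ c → c := c :* con 1 :* con 1) refl cc)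
    ; has-τ₁ = member (ℕ.≤-trans (s≤s z≤n) 2≤m∸1) b∈ (solve 2 (λ c b → c :* b := c :* b :* con 1) refl cc b)
    ; has-τ₂ = member 2≤m∸1 (𝔽-1 2) (solve 2 (λ c g → c :* g := c :* con 1 :* (g :* con 1)) refl cc γ)
    ; independent = independent-scale cc≉0 independent-1,b,γ
    }
    where
    3≤m : 3 ≤ m
    3≤m = ℕ.≰⇒> λ m≤2 → ℕ.<⇒≱ (≡.subst (5 ≤_) n≡2m 5≤n) (ℕ.*-monoʳ-≤ 2 m≤2)

    2≤m∸1 : 2 ≤ m ℕ.∸ 1
    2≤m∸1 = ℕ.∸-monoˡ-≤ 1 3≤m

    n≡ : n ≡ 2 ℕ.* (m ℕ.∸ 1 ℕ.+ 1)
    n≡ = ≡.trans n≡2m (cong (2 ℕ.*_) (≡.sym (ℕ.m∸n+n≡m (ℕ.≤-trans (s≤s z≤n) 3≤m))))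

    b∈ : 𝔽 2 b
    b∈ = proj₁ (gen b) (λ _ _ _ Pb → Pb)

    b∉ : ¬ 𝔽 1 b
    b∉ = generator∉𝔽 1 2 (m ℕ.∸ 1) n≡ gen (s≤s z≤n) (s≤s (s≤s z≤n))

    γ∉ : ¬ 𝔽 2 γ
    -- Otherwise K = 𝔽_{q²}(γ) would be contained in `𝔽 2`, although n > 2.
    γ∉ γ∈ = 𝔽-⊈ 2 n 0 n≡n*1 (s≤s z≤n) (ℕ.≤-trans (s≤s (s≤s (s≤s z≤n))) 5≤n)
      λ x _ → proj₂ (genγ x) tt (𝔽 2) (𝔽-isSubfield 2) (λ _ y∈ → y∈) γ∈

    independent-1,b,γ : Independent₃ 1# b γ
    independent-1,b,γ x y z x∈ y∈ z∈ e
      -- The relation is first read over `𝔽 2` as (x + yb) + zγ, then its constant part over `𝔽 1`.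
      with affine-independence 2 γ∉ (𝔽-+ 2 (Fq⊆𝔽 2 x∈) (𝔽-* 2 (Fq⊆𝔽 2 y∈) b∈)) (Fq⊆𝔽 2 z∈)
             (trans (+-congʳ (+-congʳ (sym (*-identityʳ x)))) e)
    ... | z≈0 , x+yb≈0 with affine-independence 1 b∉ x∈ y∈ x+yb≈0
    ...   | y≈0 , x≈0 = x≈0 , y≈0 , z≈0

    member : ∀ {d y u} → d < m ℕ.∸ 1 → 𝔽 2 y → u ≈ cc * y * pow γ d → U₃ m a b cc γ (u , 0#)
    member {y = y} d< y∈ u≈ = δ (fromℕ< d<) y , 0# , 0# , δ-𝔽 2 (fromℕ< d<) y∈ , 𝔽-0 1 , 𝔽-0 1
      , trans u≈ (trans (sym (sumF-monomial cc γ d< y)) (u≈u+0+0*a _ a)) , 0≈0+0*b b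

-- Comparison of the three pairs of families.

open import Data.Nat using (_^_)

theorem4p4 : ∀ {c ℓ} (q n : ℕ) → IsPrimePower q → 5 ≤ n
  → (K : Fld c ℓ) → HasCard K (q ^ n)
  → let open Fld K using (Carrier) in
    let open FieldDefs K q n in
    (∀ (a₁ b₁ c₁ : Carrier) (t l : ℕ) (S : Sub) (a₂ b₂ c₂ : Carrier)
       → Hyp₁ a₁ b₁ c₁ → Hyp₂ t l S a₂ b₂ c₂
       → ¬ ΓLEquiv (U₁ a₁ b₁ c₁) (U₂ t S a₂ b₂ c₂) × ¬ ΓLEquiv (U₂ t S a₂ b₂ c₂) (U₁ a₁ b₁ c₁))
  × (∀ (a₁ b₁ c₁ : Carrier) (m : ℕ) (a₃ b₃ c₃ γ : Carrier)
       → Hyp₁ a₁ b₁ c₁ → Hyp₃ m a₃ b₃ c₃ γ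
       → ¬ ΓLEquiv (U₁ a₁ b₁ c₁) (U₃ m a₃ b₃ c₃ γ) × ¬ ΓLEquiv (U₃ m a₃ b₃ c₃ γ) (U₁ a₁ b₁ c₁))
  × (∀ (t l : ℕ) (S : Sub) (a₂ b₂ c₂ : Carrier) (m : ℕ) (a₃ b₃ c₃ γ : Carrier)
       → Hyp₂ t l S a₂ b₂ c₂ → Hyp₃ m a₃ b₃ c₃ γ
       → ¬ ΓLEquiv (U₂ t S a₂ b₂ c₂) (U₃ m a₃ b₃ c₃ γ) × ¬ ΓLEquiv (U₃ m a₃ b₃ c₃ γ) (U₂ t S a₂ b₂ c₂))
theorem4p4 q n q-primePower 5≤n K card =
    -- In each pair the family of larger degree comes first: n against t, n against 2, t against 2.
    (λ a₁ b₁ c₁ t l S a₂ b₂ c₂ h₁ h₂ →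
       inequivalent (ℕ.≤-trans (s≤s z≤n) (3≤t h₂)) (t<n h₂) (shape₁ 5≤n h₁) (shape₂ h₂))
  , (λ a₁ b₁ c₁ m a₃ b₃ c₃ γ h₁ h₃ →
       inequivalent (s≤s z≤n) (ℕ.≤-trans (s≤s (s≤s (s≤s z≤n))) 5≤n) (shape₁ 5≤n h₁) (shape₃ m 5≤n h₃))
  , (λ t l S a₂ b₂ c₂ m a₃ b₃ c₃ γ h₂ h₃ →
       inequivalent (s≤s z≤n) (3≤t h₂) (shape₂ h₂) (shape₃ m 5≤n h₃))
  where
  open FieldDefs K q n using (Hyp₂)
  open Inequivalence q n q-primePower K card

  3≤t : ∀ {t l S a b cc} → Hyp₂ t l S a b cc → 3 ≤ t
  3≤t (lift (_ , _ , 3≤t , _) , _) = 3≤t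

  t<n : ∀ {t l S a b cc} → Hyp₂ t l S a b cc → t < n
  t<n {t} (lift (_ , _ , _ , t+3≤n) , _) = ℕ.≤-trans (ℕ.m<m+n t (s≤s z≤n)) t+3≤n
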